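{- Let $G$ be a finite simple graph and $e$ a pair of distinct vertices of $G$. For each $i\ge0$, $$a_i(G+e)=a_i(G)+\sum_{J\in\mathcal{E}\mathcal{C}(G+e)\setminus\mathcal{E}\mathcal{C}(G)}|b(G|_J)|\cdot a_{i-\frac{|J|}{2}}\big((G+e)^\ast_J\big).$$
   Context: All graphs are finite simple graphs; $G|_I$ is the induced subgraph on $I\subseteq V(G)$. The signed $a$-number: $sa(\emptyset)=1$ for the null graph; if $G$ has connected components $G_1,\dots,G_\ell$, $sa(G)=\prod_k sa(G_k)$; if $G$ is connected and nonempty, $sa(G)=-\sum_{I\subsetneq V(G)}sa(G|_I)$ when $|V(G)|$ is even and $sa(G)=0$ when $|V(G)|$ is odd. The $a$-number is $a(G)=|sa(G)|$; for an integer $i$, $a_i(G)=\sum_{I\subseteq V(G),\,|I|=2i}a(G|_I)$ (so $a_i(G)=0$ if $i<0$ or $2i>|V(G)|$). The $b$-number is $b(G)=\sum_{I\subseteq V(G)}sa(G|_I)$. $\mathcal{E}\mathcal{C}(G)=\{I\subseteq V(G): G|_I\text{ has no connected component of odd order}\}$. $G+e$ is $G$ with $e$ added as an edge ($G+e=G$ if $e\in E(G)$). The reconnected complement $H^\ast_J$ of $J\subseteq V(H)$ is the graph on $V(H)\setminus J$ in which $\{a,b\}$ is an edge iff there is a path from $a$ to $b$ in $H|_{J\cup\{a,b\}}$. -}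

module Defs where

open import Data.Fin using (Fin)
import Data.Fin as Fin
import Data.Fin.Properties as Fin
open import Data.Fin.Subset using (Subset; inside; outside; _∈_; _∉_; _⊆_; _⊂_; _∩_; _∪_; _─_; ⁅_⁆; ∣_∣; Nonempty; Empty)
open import Data.Fin.Subset.Properties using (_∈?_; _⊆?_; _⊂?_; nonempty?; anySubset?; x∈p∩q⁺; p∩q⊆q; p⊂q⇒∣p∣<∣q∣; p⊆q⇒∣p∣≤∣q∣; ∪-comm; drop-there)
open import Data.Integer using (ℤ; +_; -_)
import Data.Integer as ℤ
import Data.Integer.Properties as ℤ
open import Data.List using (List; []; _∷_; [_]; _++_; map; filter; foldr; allFin)
open import Data.List.Membership.Propositional using () renaming (_∈_ to _∈ˡ_)
open import Data.List.Membership.Propositional.Properties using (∈-allFin)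
open import Data.List.Properties using (map-cong-local)
open import Data.List.Relation.Unary.All using (All)
import Data.List.Relation.Unary.All as All
open import Data.List.Relation.Unary.All.Properties using (all-filter)
open import Data.List.Relation.Unary.Any using (here; there)
open import Data.Nat using (ℕ; zero; suc; _≤_; _<_; z≤n; s≤s)
import Data.Nat as ℕ
import Data.Nat.Properties as ℕ
open import Data.Nat.Divisibility using (_∣_; _∣?_)
open import Data.Nat.ListAction using (sum)
open import Data.Product using (∃; _×_; _,_; proj₁; proj₂)
open import Data.Sum using (_⊎_; inj₁; inj₂)
open import Data.Vec using ([]; _∷_)
open import Function using (_∘_)
open import Function.Bundles using (_⇔_; mk⇔; Equivalence)
open import Level using (0ℓ)
open import Relation.Binary using (Rel; Symmetric; Irreflexive)
import Relation.Binary as B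
open import Relation.Binary.Construct.Closure.ReflexiveTransitive using (Star; ε; _◅_; _◅◅_; reverse)
open import Relation.Binary.PropositionalEquality using (_≡_; _≢_; refl; sym; trans; cong; subst)
open import Relation.Nullary using (¬_; Dec; yes; no; contradiction)
open import Relation.Nullary.Decidable using (map′; ¬?; _×-dec_; _⊎-dec_; _→-dec_)
open import Relation.Unary using (Pred; Decidable)

private
  variable
    n : ℕ

-- Decidability of reachability for a decidable relation on Fin n, by
-- Warshall's algorithm: Via R? vs x y says that there is a walk from x to y
-- whose interior points all lie in vs.

module Reachability {R : Rel (Fin n) 0ℓ} (R? : B.Decidable R) where

  Via : List (Fin n) → Rel (Fin n) 0ℓ
  Via []       x y = x ≡ y ⊎ R x y
  Via (v ∷ vs) x y = Via vs x y ⊎ (Via vs x v × Via vs v y)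

  via? : ∀ vs → B.Decidable (Via vs)
  via? []       x y = (x Fin.≟ y) ⊎-dec R? x y
  via? (v ∷ vs) x y = via? vs x y ⊎-dec (via? vs x v ×-dec via? vs v y)

  sound : ∀ vs {x y} → Via vs x y → Star R x y
  sound []       (inj₁ refl)    = ε
  sound []       (inj₂ r)       = r ◅ ε
  sound (v ∷ vs) (inj₁ p)       = sound vs p
  sound (v ∷ vs) (inj₂ (p , q)) = sound vs p ◅◅ sound vs q

  base : ∀ vs {x y} → x ≡ y ⊎ R x y → Via vs x y
  base []       p = p
  base (v ∷ vs) p = inj₁ (base vs p)

  join : ∀ vs {x y z} → z ∈ˡ vs → Via vs x z → Via vs z y → Via vs x y
  join (v ∷ vs) (here refl) p q = inj₂ (to p , from q)
    where
    to : ∀ {x} → Via (v ∷ vs) x v → Via vs x v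
    to (inj₁ p)       = p
    to (inj₂ (p , _)) = p
    from : ∀ {y} → Via (v ∷ vs) v y → Via vs v y
    from (inj₁ q)       = q
    from (inj₂ (_ , q)) = q
  join (v ∷ vs) (there z∈) (inj₁ p)        (inj₁ q)        = inj₁ (join vs z∈ p q)
  join (v ∷ vs) (there z∈) (inj₁ p)        (inj₂ (q , q′)) = inj₂ (join vs z∈ p q , q′)
  join (v ∷ vs) (there z∈) (inj₂ (p , p′)) (inj₁ q)        = inj₂ (p , join vs z∈ p′ q)
  join (v ∷ vs) (there z∈) (inj₂ (p , _))  (inj₂ (_ , q′)) = inj₂ (p , q′)

  complete : ∀ {x y} → Star R x y → Via (allFin n) x y
  complete ε            = base (allFin n) (inj₁ refl)
  complete (r ◅ p) =
    join (allFin n) (∈-allFin _) (base (allFin n) (inj₂ r)) (complete p)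

  star? : B.Decidable (Star R)
  star? x y = map′ (sound (allFin n)) complete (via? (allFin n) x y)

subsets : ∀ n → List (Subset n)
subsets zero    = [ [] ]
subsets (suc n) = map (outside ∷_) (subsets n) ++ map (inside ∷_) (subsets n)

∑ : {P : Pred (Subset n) 0ℓ} → Decidable P → (Subset n → ℕ) → ℕ
∑ P? f = sum (map f (filter P? (subsets _)))

∑ℤ ∏ℤ : {P : Pred (Subset n) 0ℓ} → Decidable P → (Subset n → ℤ) → ℤ
∑ℤ P? f = foldr ℤ._+_ (+ 0) (map f (filter P? (subsets _)))
∏ℤ P? f = foldr ℤ._*_ (+ 1) (map f (filter P? (subsets _)))

-- A finite simple graph. The vertex set is an arbitrary subset of Fin n, so
-- that induced subgraphs and reconnected complements are again of this type.

record Graph (n : ℕ) : Set₁ where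
  infix 4 _~_ _~?_
  field
    V        : Subset n
    _~_      : Rel (Fin n) 0ℓ
    _~?_     : B.Decidable _~_
    ~-sym    : Symmetric _~_
    ~-irrefl : Irreflexive _≡_ _~_
    ~⇒∈      : ∀ {x y} → x ~ y → x ∈ V

open Graph public using (V)

infixl 7 _∣ᴳ_

-- Intended for I ⊆ V G, where V (G ∣ᴳ I) is I.
_∣ᴳ_ : Graph n → Subset n → Graph n
G ∣ᴳ I = record
  { V        = V G ∩ I
  ; _~_      = λ x y → x ~ y × x ∈ I × y ∈ I
  ; _~?_     = λ x y → (x ~? y) ×-dec (x ∈? I) ×-dec (y ∈? I)
  ; ~-sym    = λ (r , x∈ , y∈) → ~-sym r , y∈ , x∈
  ; ~-irrefl = λ eq (r , _) → ~-irrefl eq r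
  ; ~⇒∈      = λ (r , x∈ , _) → x∈p∩q⁺ (~⇒∈ r , x∈)
  }
  where open Graph G hiding (V)

Path : (G : Graph n) → Rel (Fin n) 0ℓ
Path G = Star (Graph._~_ G)

path? : (G : Graph n) → B.Decidable (Path G)
path? G = Reachability.star? (Graph._~?_ G)

Connected : Graph n → Set
Connected G = ∀ x y → x ∈ V G → y ∈ V G → Path G x y

connected? : (G : Graph n) → Dec (Connected G)
connected? G = Fin.all? λ x → Fin.all? λ y →
  (x ∈? V G) →-dec (y ∈? V G) →-dec path? G x y

IsComponent : Graph n → Pred (Subset n) 0ℓ
IsComponent G C = ∃ λ v → v ∈ V G × (∀ w → w ∈ C ⇔ Path G v w)

isComponent? : (G : Graph n) → Decidable (IsComponent G)
isComponent? G C = Fin.any? λ v → (v ∈? V G) ×-dec Fin.all? λ w →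
  map′ (λ (f , g) → mk⇔ f g) (λ e → Equivalence.to e , Equivalence.from e)
       (((w ∈? C) →-dec path? G v w) ×-dec (path? G v w →-dec (w ∈? C)))

-- saUpTo k G is the signed a-number of G provided ∣ V G ∣ ≤ k: every
-- recursive call is made on a graph with fewer vertices. The defining
-- equations of sa are proved below.

saUpTo : ℕ → Graph n → ℤ
saUpTo zero    G = + 1
saUpTo (suc k) G with nonempty? (V G) | connected? G | 2 ∣? ∣ V G ∣
... | no  _ | _     | _     = + 1
... | yes _ | no  _ | _     = ∏ℤ (isComponent? G) (λ C → saUpTo k (G ∣ᴳ C))
... | yes _ | yes _ | yes _ = - ∑ℤ (_⊂? V G) (λ I → saUpTo k (G ∣ᴳ I))
... | yes _ | yes _ | no  _ = + 0

sa : Graph n → ℤ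
sa G = saUpTo ∣ V G ∣ G

private
  map-filter-cong : {A : Set} {P : Pred (Subset n) 0ℓ} (P? : Decidable P) {f g : Subset n → A} →
    (∀ I → P I → f I ≡ g I) → map f (filter P? (subsets n)) ≡ map g (filter P? (subsets n))
  map-filter-cong P? eq = map-cong-local (All.map (eq _) (all-filter P? (subsets _)))

  nonempty⇒0< : {p : Subset n} → Nonempty p → 0 < ∣ p ∣
  nonempty⇒0< {p = inside  ∷ p} _                 = s≤s z≤n
  nonempty⇒0< {p = outside ∷ p} (Fin.suc x , x∈p) = nonempty⇒0< (x , drop-there x∈p)

  ∣∣ᴳ⊂∣ : (G : Graph n) {I : Subset n} → I ⊂ V G → ∣ V (G ∣ᴳ I) ∣ < ∣ V G ∣
  ∣∣ᴳ⊂∣ G {I} I⊂V = ℕ.≤-<-trans (p⊆q⇒∣p∣≤∣q∣ (p∩q⊆q (V G) I)) (p⊂q⇒∣p∣<∣q∣ I⊂V)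

  path-∈ : (G : Graph n) {x y : Fin n} → Path G x y → x ∈ V G → y ∈ V G
  path-∈ G ε       x∈ = x∈
  path-∈ G (r ◅ p) _  = path-∈ G p (Graph.~⇒∈ G (Graph.~-sym G r))

  component-⊂ : (G : Graph n) {C : Subset n} → ¬ Connected G → IsComponent G C → C ⊂ V G
  component-⊂ G {C} ¬conn (v , v∈ , C⇔) = C⊆V , x , x∈V , x∉C
    where
    C⊆V : C ⊆ V G
    C⊆V {w} w∈C = path-∈ G (Equivalence.to (C⇔ w) w∈C) v∈
    conn : V G ⊆ C → Connected G
    conn V⊆C x y x∈ y∈ =
      reverse (Graph.~-sym G) (Equivalence.to (C⇔ x) (V⊆C x∈)) ◅◅ Equivalence.to (C⇔ y) (V⊆C y∈)
    missing : ∃ λ x → x ∈ V G × x ∉ C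
    missing with Fin.any? (λ x → (x ∈? V G) ×-dec ¬? (x ∈? C))
    ... | yes w  = w
    ... | no ¬w = contradiction (conn V⊆C) ¬conn
      where
      V⊆C : V G ⊆ C
      V⊆C {x} x∈V with x ∈? C
      ... | yes x∈C = x∈C
      ... | no  x∉C = contradiction (x , x∈V , x∉C) ¬w
    x = proj₁ missing
    x∈V = proj₁ (proj₂ missing)
    x∉C = proj₂ (proj₂ missing)

  fuel : ∀ k l (G : Graph n) → ∣ V G ∣ ≤ k → ∣ V G ∣ ≤ l → saUpTo k G ≡ saUpTo l G
  fuel zero    zero    G _ _ = refl
  fuel zero    (suc l) G p _ with nonempty? (V G) | connected? G | 2 ∣? ∣ V G ∣
  ... | no  _  | _ | _ = refl
  ... | yes ne | _ | _ = contradiction p (ℕ.<⇒≱ (nonempty⇒0< ne))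
  fuel (suc k) zero    G _ q with nonempty? (V G) | connected? G | 2 ∣? ∣ V G ∣
  ... | no  _  | _ | _ = refl
  ... | yes ne | _ | _ = contradiction q (ℕ.<⇒≱ (nonempty⇒0< ne))
  fuel (suc k) (suc l) G p q with nonempty? (V G) | connected? G | 2 ∣? ∣ V G ∣
  ... | no  _ | _     | _     = refl
  ... | yes _ | yes _ | no  _ = refl
  ... | yes _ | yes _ | yes _ = cong (-_ ∘ foldr ℤ._+_ (+ 0)) (map-filter-cong (_⊂? V G) λ I I⊂V →
          fuel k l (G ∣ᴳ I) (ℕ.s≤s⁻¹ (ℕ.≤-trans (∣∣ᴳ⊂∣ G I⊂V) p)) (ℕ.s≤s⁻¹ (ℕ.≤-trans (∣∣ᴳ⊂∣ G I⊂V) q)))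
  ... | yes _ | no ¬c | _     = cong (foldr ℤ._*_ (+ 1)) (map-filter-cong (isComponent? G) λ C isC →
          let C⊂V = component-⊂ G ¬c isC in
          fuel k l (G ∣ᴳ C) (ℕ.s≤s⁻¹ (ℕ.≤-trans (∣∣ᴳ⊂∣ G C⊂V) p)) (ℕ.s≤s⁻¹ (ℕ.≤-trans (∣∣ᴳ⊂∣ G C⊂V) q)))

  saUpTo-suc : (G : Graph n) → sa G ≡ saUpTo (suc ∣ V G ∣) G
  saUpTo-suc G = fuel _ _ G ℕ.≤-refl (ℕ.n≤1+n _)

sa-null : (G : Graph n) → Empty (V G) → sa G ≡ + 1
sa-null G e rewrite saUpTo-suc G with nonempty? (V G) | connected? G | 2 ∣? ∣ V G ∣
... | no  _  | _ | _ = refl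
... | yes ne | _ | _ = contradiction ne e

sa-disconnected : (G : Graph n) → Nonempty (V G) → ¬ Connected G →
  sa G ≡ ∏ℤ (isComponent? G) (λ C → sa (G ∣ᴳ C))
sa-disconnected G ne ¬c rewrite saUpTo-suc G with nonempty? (V G) | connected? G | 2 ∣? ∣ V G ∣
... | no e  | _     | _ = contradiction ne e
... | yes _ | yes c | _ = contradiction c ¬c
... | yes _ | no _  | _ = cong (foldr ℤ._*_ (+ 1)) (map-filter-cong (isComponent? G) λ C isC →
        fuel _ _ (G ∣ᴳ C) (ℕ.<⇒≤ (∣∣ᴳ⊂∣ G (component-⊂ G ¬c isC))) ℕ.≤-refl)

sa-even : (G : Graph n) → Nonempty (V G) → Connected G → 2 ∣ ∣ V G ∣ →
  sa G ≡ - ∑ℤ (_⊂? V G) (λ I → sa (G ∣ᴳ I))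
sa-even G ne c ev rewrite saUpTo-suc G with nonempty? (V G) | connected? G | 2 ∣? ∣ V G ∣
... | no e  | _     | _     = contradiction ne e
... | yes _ | no ¬c | _     = contradiction c ¬c
... | yes _ | yes _ | no ¬e = contradiction ev ¬e
... | yes _ | yes _ | yes _ = cong (-_ ∘ foldr ℤ._+_ (+ 0)) (map-filter-cong (_⊂? V G) λ I I⊂V →
        fuel _ _ (G ∣ᴳ I) (ℕ.<⇒≤ (∣∣ᴳ⊂∣ G I⊂V)) ℕ.≤-refl)

sa-odd : (G : Graph n) → Nonempty (V G) → Connected G → ¬ 2 ∣ ∣ V G ∣ → sa G ≡ + 0
sa-odd G ne c od rewrite saUpTo-suc G with nonempty? (V G) | connected? G | 2 ∣? ∣ V G ∣
... | no e  | _     | _     = contradiction ne e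
... | yes _ | no ¬c | _     = contradiction c ¬c
... | yes _ | yes _ | yes e = contradiction e od
... | yes _ | yes _ | no  _ = refl

a : Graph n → ℕ
a G = ℤ.∣ sa G ∣

aᵢ : ℤ → Graph n → ℕ
aᵢ i G = ∑ (λ I → (I ⊆? V G) ×-dec (+ ∣ I ∣ ℤ.≟ + 2 ℤ.* i)) (λ I → a (G ∣ᴳ I))

b : Graph n → ℤ
b G = ∑ℤ (_⊆? V G) (λ I → sa (G ∣ᴳ I))

EC : Graph n → Pred (Subset n) 0ℓ
EC G I = I ⊆ V G × ¬ (∃ λ C → IsComponent (G ∣ᴳ I) C × ¬ 2 ∣ ∣ C ∣)

ec? : (G : Graph n) → Decidable (EC G)
ec? G I = (I ⊆? V G) ×-dec
  ¬? (anySubset? λ C → isComponent? (G ∣ᴳ I) C ×-dec ¬? (2 ∣? ∣ C ∣))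

record VertexPair (G : Graph n) : Set where
  field
    u v : Fin n
    u∈V : u ∈ V G
    v∈V : v ∈ V G
    u≢v : u ≢ v

infixl 6 _+ᴳ_

_+ᴳ_ : (G : Graph n) → VertexPair G → Graph n
G +ᴳ e = record
  { V        = V G
  ; _~_      = λ x y → x ~ y ⊎ (x ≡ u × y ≡ v) ⊎ (x ≡ v × y ≡ u)
  ; _~?_     = λ x y → (x ~? y) ⊎-dec ((x Fin.≟ u) ×-dec (y Fin.≟ v))
                                ⊎-dec ((x Fin.≟ v) ×-dec (y Fin.≟ u))
  ; ~-sym    = λ { (inj₁ r)                → inj₁ (~-sym r)
                 ; (inj₂ (inj₁ (xu , yv))) → inj₂ (inj₂ (yv , xu))
                 ; (inj₂ (inj₂ (xv , yu))) → inj₂ (inj₁ (yu , xv)) }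
  ; ~-irrefl = λ { refl (inj₁ r)                → ~-irrefl refl r
                 ; refl (inj₂ (inj₁ (xu , xv))) → u≢v (trans (sym xu) xv)
                 ; refl (inj₂ (inj₂ (xv , xu))) → u≢v (trans (sym xu) xv) }
  ; ~⇒∈      = λ { (inj₁ r)                → ~⇒∈ r
                 ; (inj₂ (inj₁ (xu , _))) → subst (_∈ V G) (sym xu) u∈V
                 ; (inj₂ (inj₂ (xv , _))) → subst (_∈ V G) (sym xv) v∈V }
  }
  where
  open Graph G hiding (V)
  open VertexPair e

reconnectedComplement : Graph n → Subset n → Graph n
reconnectedComplement H J = record
  { V        = V H ─ J
  ; _~_      = λ x y → x ∈ V H ─ J × y ∈ V H ─ J × x ≢ y × Path (via x y) x y
  ; _~?_     = λ x y → (x ∈? V H ─ J) ×-dec (y ∈? V H ─ J) ×-dec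
                       ¬? (x Fin.≟ y) ×-dec path? (via x y) x y
  ; ~-sym    = λ {x} {y} (x∈ , y∈ , x≢y , p) → y∈ , x∈ , x≢y ∘ sym ,
                 subst (λ S → Path (H ∣ᴳ (J ∪ S)) y x) (∪-comm ⁅ x ⁆ ⁅ y ⁆)
                       (reverse (Graph.~-sym (via x y)) p)
  ; ~-irrefl = λ x≡y (_ , _ , x≢y , _) → x≢y x≡y
  ; ~⇒∈      = proj₁
  }
  where
  via : Fin _ → Fin _ → Graph _
  via x y = H ∣ᴳ (J ∪ (⁅ x ⁆ ∪ ⁅ y ⁆))

{-# OPTIONS --safe #-}
-- Write H = G + e. The signed identity
--   sa(H) = sa(G) − Σ_J b(G|J) sa(H*_J),   J ∈ EC(H) ∖ EC(G),
-- holds because its right-hand side satisfies the recursion that defines sa(H).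
-- If |V| is odd, both sides vanish. If H is disconnected, both sides factor
-- along the component of H containing e. If H is connected of even order, then
-- summing the right-hand side over all induced subgraphs gives
-- b(G) − Σ_J b(G|J) b(H*_J), and this is 0 = b(H), because H*_J is connected of
-- even order and so b(H*_J) = 0 unless J = V. Summing the identity over induced
-- subgraphs gives the same identity for b in place of sa. If b(G|J) ≠ 0, then G|J
-- consists of two odd components, so induction on the number of edges determines
-- the signs: (−1)^⌊|V|/2⌋ b(G) ≥ 0 for G connected of odd order,
-- and then (−1)^⌊|V|/2⌋ sa(G) ≥ 0 for all G. With these signs the identity for
-- H|I becomes the unsigned one, and summing over |I| = 2i yields the theorem.
module Submission where

open import Defs
open import Algebra.Structures using (IsCommutativeMonoid)
open import Data.Bool using (true; false)
open import Data.Bool.Properties using () renaming (_≟_ to _≟ᵇ_)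
open import Data.Fin using (Fin)
import Data.Fin as Fin
import Data.Fin.Properties as Fin
open import Data.Fin.Subset using (Subset; inside; outside; _∈_; _∉_; _⊆_; _⊂_; _∩_; _∪_; _─_; ∁; ⊥; ⁅_⁆; ∣_∣; Nonempty; Empty)
open import Data.Fin.Subset.Properties
open import Data.Integer using (ℤ; +_; _-_)
import Data.Integer as ℤ
import Data.Integer.Properties as ℤ
open import Data.Integer.Solver using (module +-*-Solver)
open import Data.List using (List; []; _∷_; _++_; map; filter; foldr; allFin; cartesianProduct)
open import Data.List.Membership.Propositional.Properties using (∈-allFin; ∈-cartesianProduct⁺)
open import Data.List.Properties using (map-∘)
open import Data.List.Relation.Unary.Any using (Any; here; there)
import Data.List.Relation.Unary.Any as Any
open import Data.Nat using (ℕ; zero; suc; _+_; _*_; _/_; _<_; s≤s; z≤n)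
import Data.Nat.Properties as ℕ
open import Data.Nat.Divisibility using (_∣_; _∣?_; divides; ∣m∣n⇒∣m+n; ∣m+n∣m⇒∣n; _∣0)
open import Data.Nat.DivMod using (m*n/n≡m)
open import Data.Nat.ListAction using (sum)
open import Data.Product using (∃; _×_; _,_; proj₁; proj₂)
open import Data.Product.Properties using () renaming (≡-dec to ×-≡-dec)
open import Data.Sum using (_⊎_; inj₁; inj₂)
import Data.Sum as ⊎
open import Data.Vec using ([]; _∷_; here; there; tabulate)
open import Data.Vec.Properties using (≡-dec; []=⇒lookup; lookup⇒[]=; lookup∘tabulate)
open import Function using (_∘_; id; case_of_)
open import Function.Bundles using (_⇔_; mk⇔; Equivalence)
open import Level using (0ℓ)
open import Relation.Binary using (Rel)
open import Relation.Binary.Construct.Closure.ReflexiveTransitive using (ε; _◅_; _◅◅_; reverse)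
import Relation.Binary.Construct.Closure.ReflexiveTransitive as Star
open import Relation.Binary.PropositionalEquality using (_≡_; _≢_; refl; sym; trans; cong; cong₂; subst; module ≡-Reasoning)
open import Relation.Nullary using (¬_; Dec; yes; no; contradiction; does)
open import Relation.Nullary.Decidable using (_×-dec_; _⊎-dec_; ¬?; dec-true; decidable-stable)
open import Relation.Unary using (Pred; Decidable)
open Equivalence using (to; from)
open +-*-Solver using (solve; con; _:*_; _:+_; _:-_; :-_; _:=_)

-- Sums over sets of vertices

-- Why a nonzero `b(G|J)` forces two odd components: a component of `H|J` that avoids `e` is an even
-- component of `G|J`, and an even component makes `b` vanish. So `H|J` is connected of even order
-- and `e` is a bridge of it; its two sides have even total order and neither side is even. Hence
-- `|J|` is even and `|J|/2` is exact. Two odd orders also lose one unit to rounding, and the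
-- resulting sign cancels the minus sign of the signed identity. Induction on edges alone fails for
-- the signs, because `H*_J` is no subgraph of `H` and may have more edges. It has fewer vertices,
-- since `J` contains the ends of `e`, so an induction on vertices encloses the one on edges. The
-- sign of `b` precedes that of `sa`: in odd order an even `J` is proper and every graph in its term
-- is smaller, whereas for `sa` the set `J` may be all of `V`, and then `b(G|J) = b(G)` is covered
-- by no induction hypothesis. Sums over induced subgraphs can be exchanged with sums over `J`
-- because everything is hereditary: for `J ⊆ I`, `J` is gained on `I` iff it is gained, and
-- `(H|I)*_J = (H*_J)|I`.

infix 4 _≟ˢ_
_≟ˢ_ : ∀ {n} (I J : Subset n) → Dec (I ≡ J)
_≟ˢ_ = ≡-dec _≟ᵇ_

-- Integer sums, integer products and natural sums are all needed. At each instance `Σ` unfolds to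
-- the same fold as `∑ℤ`, `∏ℤ` or `∑`, so the lemmas apply to these directly.
module SubsetSum {A : Set} {_∙_ : A → A → A} {e : A} (isCM : IsCommutativeMonoid _≡_ _∙_ e) where
  open IsCommutativeMonoid isCM using (assoc; comm; identityˡ; identityʳ)
  open ≡-Reasoning

  Σ : ∀ {n} {P : Pred (Subset n) 0ℓ} → Decidable P → (Subset n → A) → A
  Σ P? f = foldr _∙_ e (map f (filter P? (subsets _)))

  private
    -- Indicator form: a filtered fold becomes a fold over the whole list `subsets`, so that folds
    -- over different predicates can be compared term by term.
    when : {P : Set} → Dec P → A → A
    when (yes _) x = x
    when (no  _) _ = e

    when-cong : {P Q : Set} (P? : Dec P) (Q? : Dec Q) {x y : A} →
      P ⇔ Q → (P → x ≡ y) → when P? x ≡ when Q? y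
    when-cong (yes p) (yes _) P⇔Q x≡y = x≡y p
    when-cong (yes p) (no ¬q) P⇔Q x≡y = contradiction (to P⇔Q p) ¬q
    when-cong (no ¬p) (yes q) P⇔Q x≡y = contradiction (from P⇔Q q) ¬p
    when-cong (no _)  (no _)  P⇔Q x≡y = refl

    when-no : {P : Set} (P? : Dec P) {x : A} → ¬ P → when P? x ≡ e
    when-no (yes p) ¬p = contradiction p ¬p
    when-no (no _)  _  = refl

    when-×-dec : {P Q : Set} (P? : Dec P) (Q? : Dec Q) {x : A} → when P? (when Q? x) ≡ when (P? ×-dec Q?) x
    when-×-dec (yes _) (yes _) = refl
    when-×-dec (yes _) (no _)  = refl
    when-×-dec (no _)  (yes _) = refl
    when-×-dec (no _)  (no _)  = refl

    when-∙ : {P : Set} (P? : Dec P) {x y : A} → when P? (x ∙ y) ≡ (when P? x ∙ when P? y)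
    when-∙ (yes _) = refl
    when-∙ (no  _) = sym (identityˡ e)

    fold : {B : Set} → List B → (B → A) → A
    fold xs f = foldr _∙_ e (map f xs)

    fold-filter : {B : Set} {P : Pred B 0ℓ} (P? : Decidable P) (xs : List B) (f : B → A) →
      fold (filter P? xs) f ≡ fold xs (λ x → when (P? x) (f x))
    fold-filter P? []       f = refl
    fold-filter P? (x ∷ xs) f with P? x
    ... | yes _ = cong (f x ∙_) (fold-filter P? xs f)
    ... | no  _ = trans (fold-filter P? xs f) (sym (identityˡ _))

    fold-cong : {B : Set} (xs : List B) {f g : B → A} → (∀ x → f x ≡ g x) → fold xs f ≡ fold xs g
    fold-cong []       f≗g = refl
    fold-cong (x ∷ xs) f≗g = cong₂ _∙_ (f≗g x) (fold-cong xs f≗g)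

    fold-ε : {B : Set} (xs : List B) → fold xs (λ _ → e) ≡ e
    fold-ε []       = refl
    fold-ε (x ∷ xs) = trans (identityˡ _) (fold-ε xs)

    interchange : ∀ w x y z → ((w ∙ x) ∙ (y ∙ z)) ≡ ((w ∙ y) ∙ (x ∙ z))
    interchange w x y z = begin
      (w ∙ x) ∙ (y ∙ z)  ≡⟨ assoc w x (y ∙ z) ⟩
      w ∙ (x ∙ (y ∙ z))  ≡⟨ cong (w ∙_) (assoc x y z) ⟨
      w ∙ ((x ∙ y) ∙ z)  ≡⟨ cong (λ t → w ∙ (t ∙ z)) (comm x y) ⟩
      w ∙ ((y ∙ x) ∙ z)  ≡⟨ cong (w ∙_) (assoc y x z) ⟩
      w ∙ (y ∙ (x ∙ z))  ≡⟨ assoc w y (x ∙ z) ⟨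
      (w ∙ y) ∙ (x ∙ z)  ∎

    fold-∙ : {B : Set} (xs : List B) (f g : B → A) → fold xs (λ x → f x ∙ g x) ≡ (fold xs f ∙ fold xs g)
    fold-∙ []       f g = sym (identityˡ e)
    fold-∙ (x ∷ xs) f g = trans (cong ((f x ∙ g x) ∙_) (fold-∙ xs f g)) (interchange _ _ _ _)

    fold-swap : {B C : Set} (xs : List B) (ys : List C) (f : B → C → A) →
      fold xs (λ x → fold ys (f x)) ≡ fold ys (λ y → fold xs (λ x → f x y))
    fold-swap []       ys f = sym (fold-ε ys)
    fold-swap (x ∷ xs) ys f = trans (cong (fold ys (f x) ∙_) (fold-swap xs ys f)) (sym (fold-∙ ys (f x) _))

    fold-++ : {B : Set} (xs ys : List B) (f : B → A) → fold (xs ++ ys) f ≡ (fold xs f ∙ fold ys f)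
    fold-++ []       ys f = sym (identityˡ _)
    fold-++ (x ∷ xs) ys f = trans (cong (f x ∙_) (fold-++ xs ys f)) (sym (assoc _ _ _))

    when-fold : {P B : Set} (P? : Dec P) (xs : List B) (f : B → A) →
      when P? (fold xs f) ≡ fold xs (λ x → when P? (f x))
    when-fold (yes _) xs f = refl
    when-fold (no  _) xs f = sym (fold-ε xs)

    fold-map : {B C : Set} (g : B → C) (xs : List B) (f : C → A) → fold (map g xs) f ≡ fold xs (f ∘ g)
    fold-map g xs f = cong (foldr _∙_ e) (sym (map-∘ xs))

    -- Each subset occurs exactly once in `subsets`. The induction follows its construction: only
    -- the half with first entry `s` contributes.
    fold-≡ : ∀ {n} (J : Subset n) (f : Subset n → A) → fold (subsets n) (λ I → when (I ≟ˢ J) (f I)) ≡ f J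
    fold-≡ []      f = identityʳ _
    fold-≡ {ℕ.suc n} (s ∷ J) f = begin
      fold (map (outside ∷_) (subsets n) ++ map (inside ∷_) (subsets n)) g
        ≡⟨ fold-++ (map (outside ∷_) (subsets n)) _ g ⟩
      fold (map (outside ∷_) (subsets n)) g ∙ fold (map (inside ∷_) (subsets n)) g
        ≡⟨ cong₂ _∙_ (fold-map (outside ∷_) (subsets n) g) (fold-map (inside ∷_) (subsets n) g) ⟩
      fold (subsets n) (g ∘ (outside ∷_)) ∙ fold (subsets n) (g ∘ (inside ∷_))
        ≡⟨ head s refl ⟩
      f (s ∷ J) ∎
      where
      g : Subset (ℕ.suc n) → A
      g I = when (I ≟ˢ (s ∷ J)) (f I)
      same : fold (subsets n) (g ∘ (s ∷_)) ≡ f (s ∷ J)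
      same = trans (fold-cong (subsets n) λ I →
                      when-cong ((s ∷ I) ≟ˢ (s ∷ J)) (I ≟ˢ J) (mk⇔ (λ { refl → refl }) (cong (s ∷_))) (λ _ → refl))
                   (fold-≡ J (f ∘ (s ∷_)))
      different : ∀ t → t ≢ s → fold (subsets n) (g ∘ (t ∷_)) ≡ e
      different t t≢s = trans (fold-cong (subsets n) λ I → when-no ((t ∷ I) ≟ˢ (s ∷ J)) λ { refl → t≢s refl })
                              (fold-ε (subsets n))
      head : ∀ t → t ≡ s → (fold (subsets n) (g ∘ (outside ∷_)) ∙ fold (subsets n) (g ∘ (inside ∷_))) ≡ f (s ∷ J)
      head true  refl = trans (cong₂ _∙_ (different outside λ ()) same) (identityˡ _)
      head false refl = trans (cong₂ _∙_ same (different inside λ ())) (identityʳ _)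

  Σ-cong : ∀ {n} {P Q : Pred (Subset n) 0ℓ} (P? : Decidable P) (Q? : Decidable Q) {f g : Subset n → A} →
    (∀ I → P I ⇔ Q I) → (∀ I → P I → f I ≡ g I) → Σ P? f ≡ Σ Q? g
  Σ-cong P? Q? {f} {g} P⇔Q f≗g = begin
    Σ P? f                                           ≡⟨ fold-filter P? (subsets _) f ⟩
    fold (subsets _) (λ I → when (P? I) (f I))       ≡⟨ fold-cong (subsets _) (λ I → when-cong (P? I) (Q? I) (P⇔Q I) (f≗g I)) ⟩
    fold (subsets _) (λ I → when (Q? I) (g I))       ≡⟨ fold-filter Q? (subsets _) g ⟨
    Σ Q? g                                           ∎

  Σ-congʳ : ∀ {n} {P : Pred (Subset n) 0ℓ} (P? : Decidable P) {f g : Subset n → A} →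
    (∀ I → P I → f I ≡ g I) → Σ P? f ≡ Σ P? g
  Σ-congʳ P? = Σ-cong P? P? λ _ → mk⇔ (λ p → p) (λ p → p)

  Σ-ε : ∀ {n} {P : Pred (Subset n) 0ℓ} (P? : Decidable P) {f : Subset n → A} → (∀ I → P I → f I ≡ e) → Σ P? f ≡ e
  Σ-ε P? {f} f≗ε = trans (Σ-congʳ P? f≗ε) (fold-ε (filter P? (subsets _)))

  Σ-∙ : ∀ {n} {P : Pred (Subset n) 0ℓ} (P? : Decidable P) (f g : Subset n → A) →
    Σ P? (λ I → f I ∙ g I) ≡ (Σ P? f ∙ Σ P? g)
  Σ-∙ P? = fold-∙ (filter P? (subsets _))

  Σ-≡ : ∀ {n} {P : Pred (Subset n) 0ℓ} (P? : Decidable P) (f : Subset n → A) (J : Subset n) →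
    (∀ I → P I ⇔ I ≡ J) → Σ P? f ≡ f J
  Σ-≡ P? f J P⇔≡ = begin
    Σ P? f                                         ≡⟨ Σ-cong P? (_≟ˢ J) P⇔≡ (λ _ _ → refl) ⟩
    Σ (_≟ˢ J) f                                    ≡⟨ fold-filter (_≟ˢ J) (subsets _) f ⟩
    fold (subsets _) (λ I → when (I ≟ˢ J) (f I))   ≡⟨ fold-≡ J f ⟩
    f J                                            ∎

  Σ-split : ∀ {n} {P Q : Pred (Subset n) 0ℓ} (P? : Decidable P) (Q? : Decidable Q) (f : Subset n → A) →
    Σ P? f ≡ (Σ (λ I → P? I ×-dec Q? I) f ∙ Σ (λ I → P? I ×-dec ¬? (Q? I)) f)
  Σ-split {n} P? Q? f = begin
    Σ P? f
      ≡⟨ fold-filter P? (subsets _) f ⟩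
    fold (subsets _) (λ I → when (P? I) (f I))
      ≡⟨ fold-cong (subsets _) (λ I → split (P? I) (Q? I)) ⟩
    fold (subsets _) (λ I → when (P? I ×-dec Q? I) (f I) ∙ when (P? I ×-dec ¬? (Q? I)) (f I))
      ≡⟨ fold-∙ (subsets n) _ _ ⟩
    fold (subsets _) (λ I → when (P? I ×-dec Q? I) (f I)) ∙ fold (subsets _) (λ I → when (P? I ×-dec ¬? (Q? I)) (f I))
      ≡⟨ cong₂ _∙_ (fold-filter (λ I → P? I ×-dec Q? I) (subsets _) f) (fold-filter (λ I → P? I ×-dec ¬? (Q? I)) (subsets _) f) ⟨
    Σ (λ I → P? I ×-dec Q? I) f ∙ Σ (λ I → P? I ×-dec ¬? (Q? I)) f
      ∎
    where
    split : {P Q : Set} (P? : Dec P) (Q? : Dec Q) {x : A} →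
      when P? x ≡ (when (P? ×-dec Q?) x ∙ when (P? ×-dec ¬? Q?) x)
    split (yes _) (yes _) = sym (identityʳ _)
    split (yes _) (no _)  = sym (identityˡ _)
    split (no _)  (yes _) = sym (identityˡ _)
    split (no _)  (no _)  = sym (identityˡ _)

  Σ-restrict : ∀ {n} {P Q : Pred (Subset n) 0ℓ} (P? : Decidable P) (Q? : Decidable Q) {f : Subset n → A} →
    (∀ I → P I → ¬ Q I → f I ≡ e) → Σ P? f ≡ Σ (λ I → P? I ×-dec Q? I) f
  Σ-restrict P? Q? {f} f≗ε = begin
    Σ P? f
      ≡⟨ Σ-split P? Q? f ⟩
    Σ (λ I → P? I ×-dec Q? I) f ∙ Σ (λ I → P? I ×-dec ¬? (Q? I)) f
      ≡⟨ cong (Σ (λ I → P? I ×-dec Q? I) f ∙_) (Σ-ε (λ I → P? I ×-dec ¬? (Q? I)) (λ I (p , ¬q) → f≗ε I p ¬q)) ⟩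
    Σ (λ I → P? I ×-dec Q? I) f ∙ e
      ≡⟨ identityʳ _ ⟩
    Σ (λ I → P? I ×-dec Q? I) f
      ∎

  Σ-swap : ∀ {m n} {P : Pred (Subset m) 0ℓ} {Q : Subset m → Pred (Subset n) 0ℓ}
    {P′ : Subset n → Pred (Subset m) 0ℓ} {Q′ : Pred (Subset n) 0ℓ}
    (P? : Decidable P) (Q? : ∀ I → Decidable (Q I)) (P′? : ∀ J → Decidable (P′ J)) (Q′? : Decidable Q′)
    (f : Subset m → Subset n → A) → (∀ I J → (P I × Q I J) ⇔ (Q′ J × P′ J I)) →
    Σ P? (λ I → Σ (Q? I) (f I)) ≡ Σ Q′? (λ J → Σ (P′? J) (λ I → f I J))
  Σ-swap {m} {n} P? Q? P′? Q′? f eq = begin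
    Σ P? (λ I → Σ (Q? I) (f I))
      ≡⟨ expand P? Q? f ⟩
    fold (subsets _) (λ I → fold (subsets _) (λ J → when (P? I ×-dec Q? I J) (f I J)))
      ≡⟨ fold-cong (subsets _) (λ I → fold-cong (subsets _) λ J →
           when-cong (P? I ×-dec Q? I J) (Q′? J ×-dec P′? J I) (eq I J) (λ _ → refl)) ⟩
    fold (subsets _) (λ I → fold (subsets _) (λ J → when (Q′? J ×-dec P′? J I) (f I J)))
      ≡⟨ fold-swap (subsets m) (subsets n) _ ⟩
    fold (subsets _) (λ J → fold (subsets _) (λ I → when (Q′? J ×-dec P′? J I) (f I J)))
      ≡⟨ expand Q′? P′? (λ J I → f I J) ⟨
    Σ Q′? (λ J → Σ (P′? J) (λ I → f I J))
      ∎
    where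
    expand : ∀ {m n} {P : Pred (Subset m) 0ℓ} {Q : Subset m → Pred (Subset n) 0ℓ}
      (P? : Decidable P) (Q? : ∀ I → Decidable (Q I)) (f : Subset m → Subset n → A) →
      Σ P? (λ I → Σ (Q? I) (f I)) ≡ fold (subsets _) (λ I → fold (subsets _) (λ J → when (P? I ×-dec Q? I J) (f I J)))
    expand {n = n} P? Q? f = begin
      Σ P? (λ I → Σ (Q? I) (f I))
        ≡⟨ fold-filter P? (subsets _) _ ⟩
      fold (subsets _) (λ I → when (P? I) (Σ (Q? I) (f I)))
        ≡⟨ fold-cong (subsets _) (λ I → trans (cong (when (P? I)) (fold-filter (Q? I) (subsets _) (f I))) (when-fold (P? I) (subsets n) _)) ⟩
      fold (subsets _) (λ I → fold (subsets _) (λ J → when (P? I) (when (Q? I J) (f I J))))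
        ≡⟨ fold-cong (subsets _) (λ I → fold-cong (subsets _) λ J → when-×-dec (P? I) (Q? I J)) ⟩
      fold (subsets _) (λ I → fold (subsets _) (λ J → when (P? I ×-dec Q? I J) (f I J)))
        ∎

  -- Insert the one-point sum over `J ≡ ψ I` and exchange the order of summation; `P′ J` is the
  -- fibre of `ψ` over `J`.
  Σ-fiber : ∀ {m n} {P : Pred (Subset m) 0ℓ} {P′ : Subset n → Pred (Subset m) 0ℓ} {Q : Pred (Subset n) 0ℓ}
    (P? : Decidable P) (P′? : ∀ J → Decidable (P′ J)) (Q? : Decidable Q) (f : Subset m → A) (ψ : Subset m → Subset n) →
    (∀ I J → (P I × J ≡ ψ I) ⇔ (Q J × P′ J I)) →
    Σ P? f ≡ Σ Q? (λ J → Σ (P′? J) f)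
  Σ-fiber P? P′? Q? f ψ eq = begin
    Σ P? f                                    ≡⟨ Σ-congʳ P? (λ I _ → Σ-≡ (_≟ˢ ψ I) (λ _ → f I) (ψ I) (λ _ → mk⇔ (λ p → p) (λ p → p))) ⟨
    Σ P? (λ I → Σ (_≟ˢ ψ I) (λ _ → f I))      ≡⟨ Σ-swap P? (λ I → _≟ˢ ψ I) P′? Q? (λ I _ → f I) eq ⟩
    Σ Q? (λ J → Σ (P′? J) f)                  ∎

  -- The case in which all fibres are points. The single equivalence makes `φ` and `ψ` mutually
  -- inverse between `P` and `Q`.
  Σ-reindex : ∀ {m n} {P : Pred (Subset m) 0ℓ} {Q : Pred (Subset n) 0ℓ} (P? : Decidable P) (Q? : Decidable Q)
    (f : Subset m → A) (φ : Subset n → Subset m) (ψ : Subset m → Subset n) →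
    (∀ I J → (P I × J ≡ ψ I) ⇔ (Q J × I ≡ φ J)) →
    Σ P? f ≡ Σ Q? (f ∘ φ)
  Σ-reindex P? Q? f φ ψ eq = trans (Σ-fiber P? (λ J → _≟ˢ φ J) Q? f ψ eq)
    (Σ-congʳ Q? (λ J _ → Σ-≡ (_≟ˢ φ J) f (φ J) (λ _ → mk⇔ (λ p → p) (λ p → p))))

  Σ-hom : ∀ {n} {P : Pred (Subset n) 0ℓ} (P? : Decidable P) (f : Subset n → A) (h : A → A) →
    h e ≡ e → (∀ x y → h (x ∙ y) ≡ (h x ∙ h y)) → Σ P? (λ I → h (f I)) ≡ h (Σ P? f)
  Σ-hom {n} P? f h h-ε h-∙ = go (filter P? (subsets n))
    where
    go : ∀ Is → fold Is (λ I → h (f I)) ≡ h (fold Is f)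
    go []       = sym h-ε
    go (I ∷ Is) = trans (cong (h (f I) ∙_) (go Is)) (sym (h-∙ (f I) (fold Is f)))

private
  variable
    n : ℕ
    u v w x y : Fin n
    G H K : Graph n
    A I J : Subset n

module Sum  = SubsetSum ℤ.+-0-isCommutativeMonoid
module Prod = SubsetSum ℤ.*-1-isCommutativeMonoid

subset-ext : (∀ x → x ∈ I ⇔ x ∈ J) → I ≡ J
subset-ext I⇔J = ⊆-antisym (λ {x} → to (I⇔J x)) (λ {x} → from (I⇔J x))

x∈p─q⇒x∉q : (p q : Subset n) → x ∈ p ─ q → x ∉ q
x∈p─q⇒x∉q (_ ∷ p) (inside  ∷ q) (there x∈) (there x∈q) = x∈p─q⇒x∉q p q x∈ x∈q
x∈p─q⇒x∉q (_ ∷ p) (outside ∷ q) (there x∈) (there x∈q) = x∈p─q⇒x∉q p q x∈ x∈q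

x∈p─q⇔ : x ∈ I ─ J ⇔ (x ∈ I × x ∉ J)
x∈p─q⇔ {I = I} {J = J} = mk⇔ (λ x∈ → p─q⊆p I J x∈ , x∈p─q⇒x∉q I J x∈) (λ (x∈I , x∉J) → x∈p∧x∉q⇒x∈p─q x∈I x∉J)

∣p∩q∣+∣p∩∁q∣≡∣p∣ : (p q : Subset n) → ∣ p ∩ q ∣ + ∣ p ∩ ∁ q ∣ ≡ ∣ p ∣
∣p∩q∣+∣p∩∁q∣≡∣p∣ []            []            = refl
∣p∩q∣+∣p∩∁q∣≡∣p∣ (outside ∷ p) (_ ∷ q)       = ∣p∩q∣+∣p∩∁q∣≡∣p∣ p q
∣p∩q∣+∣p∩∁q∣≡∣p∣ (inside  ∷ p) (outside ∷ q) = trans (ℕ.+-suc _ _) (cong suc (∣p∩q∣+∣p∩∁q∣≡∣p∣ p q))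
∣p∩q∣+∣p∩∁q∣≡∣p∣ (inside  ∷ p) (inside  ∷ q) = cong suc (∣p∩q∣+∣p∩∁q∣≡∣p∣ p q)

⟦_⟧ : {P : Pred (Fin n) 0ℓ} → Decidable P → Subset n
⟦ P? ⟧ = tabulate (does ∘ P?)

∈-⟦⟧ : {P : Pred (Fin n) 0ℓ} (P? : Decidable P) → x ∈ ⟦ P? ⟧ ⇔ P x
∈-⟦⟧ {x = x} P? = mk⇔
  (λ x∈ → does-true (P? x) (trans (sym (lookup∘tabulate _ x)) ([]=⇒lookup x∈)))
  (λ Px → lookup⇒[]= x _ (trans (lookup∘tabulate _ x) (dec-true (P? x) Px)))
  where
  does-true : {Q : Set} (Q? : Dec Q) → does Q? ≡ true → Q
  does-true (yes q) _ = q

-- Induced subgraphs and components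

infix 4 _≃_

Adj : Graph n → Rel (Fin n) 0ℓ
Adj = Graph._~_

-- Adjacency is a function into types, so graphs such as `G ∣ᴳ I ∣ᴳ J` and `G ∣ᴳ (I ∩ J)` cannot be
-- expected to be propositionally equal. This relation replaces equality, and `sa` and `b` respect
-- it.
record _≃_ (G H : Graph n) : Set where
  field
    V≡  : V G ≡ V H
    ~⇒  : Adj G x y → Adj H x y
    ~⇐  : Adj H x y → Adj G x y

open _≃_ public

≃-sym : G ≃ H → H ≃ G
≃-sym eq = record { V≡ = sym (V≡ eq) ; ~⇒ = ~⇐ eq ; ~⇐ = ~⇒ eq }

≃-trans : G ≃ H → H ≃ K → G ≃ K
≃-trans eq eq′ = record { V≡ = trans (V≡ eq) (V≡ eq′) ; ~⇒ = ~⇒ eq′ ∘ ~⇒ eq ; ~⇐ = ~⇐ eq ∘ ~⇐ eq′ }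

-- Agreement of the two sets on `V G` suffices because edges have their ends there; `rc-∪` relies on
-- this weak form.
∣ᴳ-cong : {G H : Graph n} → G ≃ H → (∀ {x} → x ∈ V G → x ∈ I ⇔ x ∈ J) → G ∣ᴳ I ≃ H ∣ᴳ J
∣ᴳ-cong {I = I} {J = J} {G = G} {H} eq I⇔J = record
  { V≡ = subset-ext λ x → mk⇔
      (λ x∈ → let v , i = x∈p∩q⁻ (V G) I x∈ in x∈p∩q⁺ (subst (x ∈_) (V≡ eq) v , to (I⇔J v) i))
      (λ x∈ → let v , j = x∈p∩q⁻ (V H) J x∈ ; v′ = subst (x ∈_) (sym (V≡ eq)) v in x∈p∩q⁺ (v′ , from (I⇔J v′) j))
  ; ~⇒ = λ (r , x∈ , y∈) → ~⇒ eq r , to (I⇔J (Graph.~⇒∈ G r)) x∈ , to (I⇔J (Graph.~⇒∈ G (Graph.~-sym G r))) y∈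
  ; ~⇐ = λ (r , x∈ , y∈) → let r′ = ~⇐ eq r in
      r′ , from (I⇔J (Graph.~⇒∈ G r′)) x∈ , from (I⇔J (Graph.~⇒∈ G (Graph.~-sym G r′))) y∈
  }

≃-refl : (G : Graph n) → G ≃ G
≃-refl G = record { V≡ = refl ; ~⇒ = id ; ~⇐ = id }

∣ᴳ-∣ᴳ : (G : Graph n) (I J : Subset n) → G ∣ᴳ I ∣ᴳ J ≃ G ∣ᴳ (I ∩ J)
∣ᴳ-∣ᴳ G I J = record
  { V≡ = ∩-assoc (V G) I J
  ; ~⇒ = λ ((r , xI , yI) , xJ , yJ) → r , x∈p∩q⁺ (xI , xJ) , x∈p∩q⁺ (yI , yJ)
  ; ~⇐ = λ (r , x∈ , y∈) → let xI , xJ = x∈p∩q⁻ I J x∈ ; yI , yJ = x∈p∩q⁻ I J y∈ in (r , xI , yI) , xJ , yJ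
  }

∣ᴳ-∣ᴳ-⊆ : (G : Graph n) → J ⊆ I → G ∣ᴳ I ∣ᴳ J ≃ G ∣ᴳ J
∣ᴳ-∣ᴳ-⊆ {J = J} {I} G J⊆I = ≃-trans (∣ᴳ-∣ᴳ G I J)
  (∣ᴳ-cong (≃-refl G) λ _ → mk⇔ (p∩q⊆q I J) (λ x∈J → x∈p∩q⁺ (J⊆I x∈J , x∈J)))

∣ᴳ-⊇ : (G : Graph n) → V G ⊆ I → G ∣ᴳ I ≃ G
∣ᴳ-⊇ {I = I} G V⊆I = record
  { V≡ = subset-ext λ x → mk⇔ (p∩q⊆p (V G) I) (λ x∈ → x∈p∩q⁺ (x∈ , V⊆I x∈))
  ; ~⇒ = proj₁
  ; ~⇐ = λ r → r , V⊆I (Graph.~⇒∈ G r) , V⊆I (Graph.~⇒∈ G (Graph.~-sym G r))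
  }

path-≃ : G ≃ H → Path G x y → Path H x y
path-≃ eq = Star.map (~⇒ eq)

connected-≃ : G ≃ H → Connected G → Connected H
connected-≃ eq c x y x∈ y∈ = path-≃ eq (c x y (subst (x ∈_) (sym (V≡ eq)) x∈) (subst (y ∈_) (sym (V≡ eq)) y∈))

isComponent-≃ : G ≃ H → IsComponent G J → IsComponent H J
isComponent-≃ eq (v , v∈ , C⇔) = v , subst (v ∈_) (V≡ eq) v∈ , λ w →
  mk⇔ (path-≃ eq ∘ to (C⇔ w)) (from (C⇔ w) ∘ path-≃ (≃-sym eq))

saUpTo-≃ : (k : ℕ) {G H : Graph n} → G ≃ H → saUpTo k G ≡ saUpTo k H
saUpTo-≃ zero eq = refl
saUpTo-≃ (suc k) {G} {H} eq
  with nonempty? (V G) | connected? G | 2 ∣? ∣ V G ∣ | nonempty? (V H) | connected? H | 2 ∣? ∣ V H ∣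
... | no  _ | _     | _     | no  _ | _     | _     = refl
... | no ¬p | _     | _     | yes p | _     | _     = contradiction (subst Nonempty (sym (V≡ eq)) p) ¬p
... | yes p | _     | _     | no ¬p | _     | _     = contradiction (subst Nonempty (V≡ eq) p) ¬p
... | yes _ | no  _ | _     | yes _ | no  _ | _     =
  Prod.Σ-cong (isComponent? G) (isComponent? H) (λ _ → mk⇔ (isComponent-≃ eq) (isComponent-≃ (≃-sym eq)))
    (λ C _ → saUpTo-≃ k (∣ᴳ-cong eq λ _ → mk⇔ id id))
... | yes _ | no ¬c | _     | yes _ | yes c | _     = contradiction (connected-≃ (≃-sym eq) c) ¬c
... | yes _ | yes c | _     | yes _ | no ¬c | _     = contradiction (connected-≃ eq c) ¬c
... | yes _ | yes _ | yes _ | yes _ | yes _ | yes _ = cong ℤ.-_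
  (Sum.Σ-cong (_⊂? V G) (_⊂? V H) (λ I → mk⇔ (subst (I ⊂_) (V≡ eq)) (subst (I ⊂_) (sym (V≡ eq))))
    (λ C _ → saUpTo-≃ k (∣ᴳ-cong eq λ _ → mk⇔ id id)))
... | yes _ | yes _ | no ¬e | yes _ | yes _ | yes e = contradiction (subst (λ v → 2 ∣ ∣ v ∣) (sym (V≡ eq)) e) ¬e
... | yes _ | yes _ | yes e | yes _ | yes _ | no ¬e = contradiction (subst (λ v → 2 ∣ ∣ v ∣) (V≡ eq) e) ¬e
... | yes _ | yes _ | no  _ | yes _ | yes _ | no _  = refl

sa-≃ : G ≃ H → sa G ≡ sa H
sa-≃ {G = G} {H} eq = trans (saUpTo-≃ ∣ V G ∣ eq) (cong (λ v → saUpTo ∣ v ∣ H) (V≡ eq))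

b-≃ : G ≃ H → b G ≡ b H
b-≃ {G = G} {H} eq =
  Sum.Σ-cong (_⊆? V G) (_⊆? V H) (λ I → mk⇔ (λ I⊆ {x} x∈ → subst (x ∈_) (V≡ eq) (I⊆ x∈))
                                            (λ I⊆ {x} x∈ → subst (x ∈_) (sym (V≡ eq)) (I⊆ x∈)))
    (λ C _ → sa-≃ (∣ᴳ-cong eq λ _ → mk⇔ id id))

-- On vertices: a union of components. Elements outside `V G` are allowed, so the other side is
-- simply `∁ A`, and the property passes to subgraphs with `A` unchanged.
Closed : Graph n → Subset n → Set
Closed G A = ∀ {x y} → Adj G x y → x ∈ A → y ∈ A

closed-∁ : (G : Graph n) → Closed G A → Closed G (∁ A)
closed-∁ G A-closed r x∉A = x∉p⇒x∈∁p λ y∈A → x∈∁p⇒x∉p x∉A (A-closed (Graph.~-sym G r) y∈A)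

closed-V : (G : Graph n) → Closed G (V G)
closed-V G r _ = Graph.~⇒∈ G (Graph.~-sym G r)

path-closed : (G : Graph n) → Closed G A → Path G x y → x ∈ A → y ∈ A
path-closed G A-closed ε       x∈A = x∈A
path-closed G A-closed (r ◅ p) x∈A = path-closed G A-closed p (A-closed r x∈A)

path-restrict : (G : Graph n) → Closed G A → x ∈ A → Path G x y → Path (G ∣ᴳ A) x y
path-restrict G A-closed x∈A ε       = ε
path-restrict G A-closed x∈A (r ◅ p) = (r , x∈A , A-closed r x∈A) ◅ path-restrict G A-closed (A-closed r x∈A) p

path-sym : (G : Graph n) → Path G x y → Path G y x
path-sym G = reverse (Graph.~-sym G)

component : Graph n → Fin n → Subset n
component G x = ⟦ path? G x ⟧

∈-component : (G : Graph n) → y ∈ component G x ⇔ Path G x y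
∈-component {x = x} G = ∈-⟦⟧ (path? G x)

isComponent-component : (G : Graph n) → x ∈ V G → IsComponent G (component G x)
isComponent-component G x∈ = _ , x∈ , λ w → ∈-component G

component-closed : (G : Graph n) (x : Fin n) → Closed G (component G x)
component-closed G x r y∈ = from (∈-component G) (to (∈-component G) y∈ ◅◅ r ◅ ε)

x∈component : (G : Graph n) (x : Fin n) → x ∈ component G x
x∈component G x = from (∈-component G) ε

component⊆V : (G : Graph n) → x ∈ V G → component G x ⊆ V G
component⊆V G x∈ y∈ = path-closed G (closed-V G) (to (∈-component G) y∈) x∈

component-connected : (G : Graph n) (x : Fin n) → Connected (G ∣ᴳ component G x)
component-connected G x y z y∈ z∈ =
  path-sym (G ∣ᴳ component G x) (walk y∈) ◅◅ walk z∈
  where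
  walk : ∀ {w} → w ∈ V (G ∣ᴳ component G x) → Path (G ∣ᴳ component G x) x w
  walk w∈ = path-restrict G (component-closed G x) (x∈component G x) (to (∈-component G) (p∩q⊆q (V G) _ w∈))

connected⇒isComponent : (G : Graph n) → Nonempty (V G) → Connected G → (C : Subset n) → IsComponent G C ⇔ C ≡ V G
connected⇒isComponent G (x , x∈) conn C = mk⇔
  (λ (v , v∈ , C⇔) → subset-ext λ w → mk⇔
    (λ w∈C → path-closed G (closed-V G) (to (C⇔ w) w∈C) v∈)
    (λ w∈V → from (C⇔ w) (conn v w v∈ w∈V)))
  (λ { refl → x , x∈ , λ w → mk⇔ (conn x w x∈) (λ p → path-closed G (closed-V G) p x∈) })

-- The product formula also covers the null graph (empty product) and connected graphs (one factor),
-- so `sa-split` needs no case distinction.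
sa-components : (G : Graph n) → sa G ≡ ∏ℤ (isComponent? G) (λ C → sa (G ∣ᴳ C))
sa-components G with nonempty? (V G) | connected? G
... | no e | _ = trans (sa-null G e) (sym (Prod.Σ-ε (isComponent? G) λ C (v , v∈ , _) → contradiction (v , v∈) e))
... | yes ne | no ¬c = sa-disconnected G ne ¬c
... | yes ne | yes c = sym (trans (Prod.Σ-≡ (isComponent? G) _ (V G) (connected⇒isComponent G ne c))
                                  (sa-≃ (∣ᴳ-⊇ G id)))

isComponent-∣ᴳ : (G : Graph n) → Closed G A → (C : Subset n) → IsComponent (G ∣ᴳ A) C ⇔ (IsComponent G C × C ⊆ A)
isComponent-∣ᴳ {A = A} G A-closed C = mk⇔
  (λ (v , v∈ , C⇔) → let v∈V , v∈A = x∈p∩q⁻ (V G) A v∈ in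
    (v , v∈V , λ w → mk⇔ (λ w∈ → Star.map proj₁ (to (C⇔ w) w∈)) (λ p → from (C⇔ w) (path-restrict G A-closed v∈A p)))
    , λ {w} w∈ → path-closed G A-closed (Star.map proj₁ (to (C⇔ w) w∈)) v∈A)
  (λ ((v , v∈V , C⇔) , C⊆A) → let v∈A = C⊆A (from (C⇔ v) ε) in
    v , x∈p∩q⁺ (v∈V , v∈A) , λ w → mk⇔ (λ w∈ → path-restrict G A-closed v∈A (to (C⇔ w) w∈)) (λ p → from (C⇔ w) (Star.map proj₁ p)))

-- No component crosses the boundary of a closed set, so each one lies in `A` or in `∁ A`.
sa-split : (G : Graph n) → Closed G A → sa G ≡ sa (G ∣ᴳ A) ℤ.* sa (G ∣ᴳ ∁ A)
sa-split {A = A} G A-closed = begin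
  sa G
    ≡⟨ sa-components G ⟩
  ∏ℤ (isComponent? G) (λ C → sa (G ∣ᴳ C))
    ≡⟨ Prod.Σ-split (isComponent? G) (_⊆? A) _ ⟩
  ∏ℤ (λ C → isComponent? G C ×-dec C ⊆? A) (λ C → sa (G ∣ᴳ C))
    ℤ.* ∏ℤ (λ C → isComponent? G C ×-dec ¬? (C ⊆? A)) (λ C → sa (G ∣ᴳ C))
    ≡⟨ cong₂ ℤ._*_ (side A-closed _ λ C _ → mk⇔ id id) (side (closed-∁ G A-closed) _ avoids) ⟨
  sa (G ∣ᴳ A) ℤ.* sa (G ∣ᴳ ∁ A)
    ∎
  where
  open ≡-Reasoning
  side : ∀ {B} {P : Pred (Subset _) 0ℓ} → Closed G B → (P? : Decidable P) → (∀ C → IsComponent G C → P C ⇔ C ⊆ B) →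
    sa (G ∣ᴳ B) ≡ ∏ℤ (λ C → isComponent? G C ×-dec P? C) (λ C → sa (G ∣ᴳ C))
  side {B} B-closed P? P⇔ = trans (sa-components (G ∣ᴳ B))
    (Prod.Σ-cong (isComponent? (G ∣ᴳ B)) (λ C → isComponent? G C ×-dec P? C)
      (λ C → mk⇔ (λ c → let c′ , C⊆B = to (isComponent-∣ᴳ G B-closed C) c in c′ , from (P⇔ C c′) C⊆B)
                 (λ (c , p) → from (isComponent-∣ᴳ G B-closed C) (c , to (P⇔ C c) p)))
      (λ C c → sa-≃ (∣ᴳ-∣ᴳ-⊆ G (proj₂ (to (isComponent-∣ᴳ G B-closed C) c)))))
  avoids : ∀ C → IsComponent G C → (¬ C ⊆ A) ⇔ C ⊆ ∁ A
  avoids C (v , v∈ , C⇔) = mk⇔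
    (λ C⊈A {w} w∈C → x∉p⇒x∈∁p λ w∈A → C⊈A λ {z} z∈C →
      path-closed G A-closed (path-sym G (to (C⇔ w) w∈C) ◅◅ to (C⇔ z) z∈C) w∈A)
    (λ C⊆∁A C⊆A → let v∈C = from (C⇔ v) ε in x∈∁p⇒x∉p (C⊆∁A v∈C) (C⊆A v∈C))

∑ℤ-*ˡ : {P : Pred (Subset n) 0ℓ} (P? : Decidable P) (c : ℤ) (f : Subset n → ℤ) →
  ∑ℤ P? (λ I → c ℤ.* f I) ≡ c ℤ.* ∑ℤ P? f
∑ℤ-*ˡ P? c f = Sum.Σ-hom P? f (c ℤ.*_) (ℤ.*-zeroʳ c) (ℤ.*-distribˡ-+ c)

∑ℤ-*ʳ : {P : Pred (Subset n) 0ℓ} (P? : Decidable P) (c : ℤ) (f : Subset n → ℤ) →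
  ∑ℤ P? (λ I → f I ℤ.* c) ≡ ∑ℤ P? f ℤ.* c
∑ℤ-*ʳ P? c f = Sum.Σ-hom P? f (ℤ._* c) (ℤ.*-zeroˡ c) (ℤ.*-distribʳ-+ c)

∑ℤ-neg : {P : Pred (Subset n) 0ℓ} (P? : Decidable P) (f : Subset n → ℤ) →
  ∑ℤ P? (λ I → ℤ.- f I) ≡ ℤ.- ∑ℤ P? f
∑ℤ-neg P? f = Sum.Σ-hom P? f ℤ.-_ refl ℤ.neg-distrib-+

∑ℤ-minus : {P : Pred (Subset n) 0ℓ} (P? : Decidable P) (f g : Subset n → ℤ) →
  ∑ℤ P? (λ I → f I ℤ.- g I) ≡ ∑ℤ P? f ℤ.- ∑ℤ P? g
∑ℤ-minus P? f g = trans (Sum.Σ-∙ P? f (λ I → ℤ.- g I)) (cong (ℤ._+_ (∑ℤ P? f)) (∑ℤ-neg P? g))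

-- Parity

odd⇒even-suc : ∀ m → ¬ 2 ∣ m → 2 ∣ suc m
odd⇒even-suc zero          odd = contradiction (2 ∣0) odd
odd⇒even-suc (suc zero)    odd = divides 1 refl
odd⇒even-suc (suc (suc m)) odd = ∣m∣n⇒∣m+n (divides 1 refl) (odd⇒even-suc m (odd ∘ ∣m∣n⇒∣m+n (divides 1 refl)))

odd+odd : ∀ {m k} → ¬ 2 ∣ m → ¬ 2 ∣ k → 2 ∣ m + k
odd+odd {m} {k} m-odd k-odd = ∣m+n∣m⇒∣n
  (subst (λ t → 2 ∣ suc t) (ℕ.+-suc m k) (∣m∣n⇒∣m+n (odd⇒even-suc m m-odd) (odd⇒even-suc k k-odd))) (divides 1 refl)

⊆∧≢⇒⊂ : I ⊆ J × I ≢ J → I ⊂ J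
⊆∧≢⇒⊂ {I = I} {J = J} (I⊆J , I≢J) with nonempty? (J ─ I)
... | yes (x , x∈) = I⊆J , x , to x∈p─q⇔ x∈
... | no  e        = contradiction (⊆-antisym I⊆J J⊆I) I≢J
  where
  J⊆I : J ⊆ I
  J⊆I {x} x∈J with x ∈? I
  ... | yes x∈I = x∈I
  ... | no  x∉I = contradiction (x , from x∈p─q⇔ (x∈J , x∉I)) e

⊂⇒⊆∧≢ : I ⊂ J → I ⊆ J × I ≢ J
⊂⇒⊆∧≢ I⊂J = p⊂q⇒p⊆q I⊂J , λ I≡J → ⊂-irref I≡J I⊂J

Empty⇒∣p∣≡0 : (p : Subset n) → Empty p → ∣ p ∣ ≡ 0
Empty⇒∣p∣≡0 {n} p e = trans (cong ∣_∣ (Empty-unique e)) (∣⊥∣≡0 n)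

odd⇒nonempty : ¬ 2 ∣ ∣ J ∣ → Nonempty J
odd⇒nonempty {J = J} odd with nonempty? J
... | yes ne = ne
... | no  e  = contradiction (subst (2 ∣_) (sym (Empty⇒∣p∣≡0 J e)) (2 ∣0)) odd

x∉∩∁ : x ∈ A → x ∉ J ∩ ∁ A
x∉∩∁ {A = A} {J = J} x∈A x∈ = x∈∁p⇒x∉p (p∩q⊆q J (∁ A) x∈) x∈A

∣∩∣<∣∣ : x ∈ J → x ∉ A → ∣ J ∩ A ∣ < ∣ J ∣
∣∩∣<∣∣ {x = x} {J = J} {A = A} x∈J x∉A = p⊂q⇒∣p∣<∣q∣ (p∩q⊆p J A , x , x∈J , x∉A ∘ p∩q⊆q J A)

-- The level is arbitrary because motives that quantify over a further graph live in `Set₁`.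
graph-induction : ∀ {ℓ} (P : Graph n → Set ℓ) →
  (∀ G → (∀ H → ∣ V H ∣ < ∣ V G ∣ → P H) → P G) → ∀ G → P G
graph-induction P step G = go (suc ∣ V G ∣) G ℕ.≤-refl
  where
  go : ∀ k G → ∣ V G ∣ < k → P G
  go (suc k) G (s≤s V≤k) = step G λ H H<G → go k H (ℕ.<-≤-trans H<G V≤k)

sa-odd-part : (G : Graph n) → Closed G A → Connected (G ∣ᴳ A) → Nonempty (V G ∩ A) → ¬ 2 ∣ ∣ V G ∩ A ∣ → sa G ≡ + 0
sa-odd-part {A = A} G A-closed c ne odd = trans (sa-split G A-closed)
  (trans (cong (ℤ._* sa (G ∣ᴳ ∁ A)) (sa-odd (G ∣ᴳ A) ne c odd)) (ℤ.*-zeroˡ (sa (G ∣ᴳ ∁ A))))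

-- Some component has odd order. If the component of `x` is even, the rest is smaller and still odd.
sa-odd-card : (G : Graph n) → ¬ 2 ∣ ∣ V G ∣ → sa G ≡ + 0
sa-odd-card = graph-induction (λ G → ¬ 2 ∣ ∣ V G ∣ → sa G ≡ + 0) step
  where
  step : (G : Graph n) → (∀ H → ∣ V H ∣ < ∣ V G ∣ → ¬ 2 ∣ ∣ V H ∣ → sa H ≡ + 0) → ¬ 2 ∣ ∣ V G ∣ → sa G ≡ + 0
  step G IH odd with odd⇒nonempty odd
  ... | x , x∈ with 2 ∣? ∣ V G ∩ component G x ∣
  ...   | no C-odd = sa-odd-part G (component-closed G x) (component-connected G x) (x , x∈p∩q⁺ (x∈ , x∈component G x)) C-odd
  ...   | yes C-even = trans (sa-split G C-closed)
            (trans (cong (sa (G ∣ᴳ C) ℤ.*_) (IH (G ∣ᴳ ∁ C) smaller rest-odd)) (ℤ.*-zeroʳ (sa (G ∣ᴳ C))))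
    where
    C = component G x
    C-closed = component-closed G x
    smaller : ∣ V G ∩ ∁ C ∣ < ∣ V G ∣
    smaller = ∣∩∣<∣∣ x∈ (λ x∈∁ → x∈∁p⇒x∉p x∈∁ (x∈component G x))
    rest-odd : ¬ 2 ∣ ∣ V G ∩ ∁ C ∣
    rest-odd e = odd (subst (2 ∣_) (∣p∩q∣+∣p∩∁q∣≡∣p∣ (V G) C) (∣m∣n⇒∣m+n C-even e))

-- Vanishing and multiplicativity of `b`

∑ℤ-⊆ : (W : Subset n) (f : Subset n → ℤ) → ∑ℤ (_⊆? W) f ≡ f W ℤ.+ ∑ℤ (_⊂? W) f
∑ℤ-⊆ W f = trans (Sum.Σ-split (_⊆? W) (_≟ˢ W) f) (cong₂ ℤ._+_
  (Sum.Σ-≡ (λ I → I ⊆? W ×-dec I ≟ˢ W) f W (λ I → mk⇔ proj₂ (λ { refl → id , refl })))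
  (Sum.Σ-cong (λ I → I ⊆? W ×-dec ¬? (I ≟ˢ W)) (_⊂? W)
    (λ I → mk⇔ ⊆∧≢⇒⊂ ⊂⇒⊆∧≢)
    (λ _ _ → refl)))

b-top : (G : Graph n) → b G ≡ sa G ℤ.+ ∑ℤ (_⊂? V G) (λ I → sa (G ∣ᴳ I))
b-top G = trans (∑ℤ-⊆ (V G) (λ I → sa (G ∣ᴳ I))) (cong (ℤ._+ ∑ℤ (_⊂? V G) (λ I → sa (G ∣ᴳ I))) (sa-≃ (∣ᴳ-⊇ G id)))

b-null : (G : Graph n) → Empty (V G) → b G ≡ + 1
b-null G e = trans (b-top G) (cong₂ ℤ._+_ (sa-null G e)
  (Sum.Σ-ε (_⊂? V G) λ I (_ , x , x∈ , _) → contradiction (x , x∈) e))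

-- The defining recursion of `sa` in this case, with the term of the whole graph moved to the other
-- side.
b-even : (G : Graph n) → Nonempty (V G) → Connected G → 2 ∣ ∣ V G ∣ → b G ≡ + 0
b-even G ne c ev = trans (b-top G) (trans (cong (ℤ._+ ∑ℤ (_⊂? V G) (λ I → sa (G ∣ᴳ I))) (sa-even G ne c ev))
  (ℤ.+-inverseˡ (∑ℤ (_⊂? V G) (λ I → sa (G ∣ᴳ I)))))

-- Subsets `I` of `V G` correspond to pairs of traces `I ∩ A`, `I ∩ ∁ A`, and `sa` factors along
-- them; the sum over pairs is then a product of two sums.
b-split : (G : Graph n) → Closed G A → b G ≡ b (G ∣ᴳ A) ℤ.* b (G ∣ᴳ ∁ A)
b-split {A = A} G A-closed = begin
  ∑ℤ (_⊆? V G) (λ I → sa (G ∣ᴳ I))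
    ≡⟨ Sum.Σ-congʳ (_⊆? V G) (λ I _ → trans
         (sa-split (G ∣ᴳ I) (λ (r , _) → A-closed r))
         (cong₂ ℤ._*_ (sa-≃ (∣ᴳ-∣ᴳ G I A)) (sa-≃ (∣ᴳ-∣ᴳ G I (∁ A))))) ⟩
  ∑ℤ (_⊆? V G) (λ I → sa (G ∣ᴳ (I ∩ A)) ℤ.* sa (G ∣ᴳ (I ∩ ∁ A)))
    ≡⟨ Sum.Σ-fiber (_⊆? V G) (λ K I → I ⊆? V G ×-dec K ≟ˢ I ∩ A) (_⊆? V G ∩ A) _ (_∩ A) traces ⟩
  ∑ℤ (_⊆? V G ∩ A) (λ K → ∑ℤ (λ I → I ⊆? V G ×-dec K ≟ˢ I ∩ A) (λ I → sa (G ∣ᴳ (I ∩ A)) ℤ.* sa (G ∣ᴳ (I ∩ ∁ A))))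
    ≡⟨ Sum.Σ-congʳ (_⊆? V G ∩ A) inner ⟩
  ∑ℤ (_⊆? V G ∩ A) (λ K → sa (G ∣ᴳ A ∣ᴳ K) ℤ.* b (G ∣ᴳ ∁ A))
    ≡⟨ ∑ℤ-*ʳ (_⊆? V G ∩ A) (b (G ∣ᴳ ∁ A)) (λ K → sa (G ∣ᴳ A ∣ᴳ K)) ⟩
  b (G ∣ᴳ A) ℤ.* b (G ∣ᴳ ∁ A)
    ∎
  where
  open ≡-Reasoning
  traces : ∀ I K → (I ⊆ V G × K ≡ I ∩ A) ⇔ (K ⊆ V G ∩ A × I ⊆ V G × K ≡ I ∩ A)
  traces I K = mk⇔
    (λ { (I⊆V , refl) → (λ x∈ → let xI , xA = x∈p∩q⁻ I A x∈ in x∈p∩q⁺ (I⊆V xI , xA)) , I⊆V , refl })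
    (λ (_ , I⊆V , eq) → I⊆V , eq)
  ∪∩∁ : ∀ {K L} → K ⊆ A → L ⊆ ∁ A → (K ∪ L) ∩ ∁ A ≡ L
  ∪∩∁ {K} {L} K⊆ L⊆ = subset-ext λ x → mk⇔
    (λ x∈ → let x∪ , x∁ = x∈p∩q⁻ (K ∪ L) (∁ A) x∈ in
      case x∈p∪q⁻ K L x∪ of λ { (inj₁ xK) → contradiction (K⊆ xK) (x∈∁p⇒x∉p x∁) ; (inj₂ xL) → xL })
    (λ xL → x∈p∩q⁺ (q⊆p∪q K L xL , L⊆ xL))
  ∪∩ : ∀ {K L} → K ⊆ A → L ⊆ ∁ A → (K ∪ L) ∩ A ≡ K
  ∪∩ {K} {L} K⊆ L⊆ = subset-ext λ x → mk⇔
    (λ x∈ → let x∪ , xA = x∈p∩q⁻ (K ∪ L) A x∈ in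
      case x∈p∪q⁻ K L x∪ of λ { (inj₁ xK) → xK ; (inj₂ xL) → contradiction xA (x∈∁p⇒x∉p (L⊆ xL)) })
    (λ xK → x∈p∩q⁺ (p⊆p∪q L xK , K⊆ xK))
  ∩∪∩∁ : ∀ I → I ≡ (I ∩ A) ∪ (I ∩ ∁ A)
  ∩∪∩∁ I = trans (sym (∩-identityʳ I)) (trans (cong (I ∩_) (sym (p∪∁p≡⊤ A))) (∩-distribˡ-∪ I A (∁ A)))
  pieces : ∀ {K} → K ⊆ V G ∩ A → ∀ I L →
    ((I ⊆ V G × K ≡ I ∩ A) × L ≡ I ∩ ∁ A) ⇔ (L ⊆ V G ∩ ∁ A × I ≡ K ∪ L)
  pieces {K} K⊆ I L = mk⇔
    (λ { ((I⊆V , refl) , refl) → (λ x∈ → let xI , x∁ = x∈p∩q⁻ I (∁ A) x∈ in x∈p∩q⁺ (I⊆V xI , x∁)) , ∩∪∩∁ I })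
    (λ { (L⊆ , refl) →
      let K⊆A : K ⊆ A
          K⊆A x∈ = p∩q⊆q (V G) A (K⊆ x∈)
          L⊆∁ : L ⊆ ∁ A
          L⊆∁ x∈ = p∩q⊆q (V G) (∁ A) (L⊆ x∈)
      in ((λ x∈ → case x∈p∪q⁻ K L x∈ of λ { (inj₁ xK) → p∩q⊆p (V G) A (K⊆ xK) ; (inj₂ xL) → p∩q⊆p (V G) (∁ A) (L⊆ xL) })
         , sym (∪∩ K⊆A L⊆∁)) , sym (∪∩∁ K⊆A L⊆∁) })
  inner : ∀ K → K ⊆ V G ∩ A →
    ∑ℤ (λ I → I ⊆? V G ×-dec K ≟ˢ I ∩ A) (λ I → sa (G ∣ᴳ (I ∩ A)) ℤ.* sa (G ∣ᴳ (I ∩ ∁ A)))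
    ≡ sa (G ∣ᴳ A ∣ᴳ K) ℤ.* b (G ∣ᴳ ∁ A)
  inner K K⊆ = begin
    ∑ℤ (λ I → I ⊆? V G ×-dec K ≟ˢ I ∩ A) (λ I → sa (G ∣ᴳ (I ∩ A)) ℤ.* sa (G ∣ᴳ (I ∩ ∁ A)))
      ≡⟨ Sum.Σ-reindex (λ I → I ⊆? V G ×-dec K ≟ˢ I ∩ A) (_⊆? V G ∩ ∁ A) _ (K ∪_) (_∩ ∁ A) (pieces K⊆) ⟩
    ∑ℤ (_⊆? V G ∩ ∁ A) (λ L → sa (G ∣ᴳ ((K ∪ L) ∩ A)) ℤ.* sa (G ∣ᴳ ((K ∪ L) ∩ ∁ A)))
      ≡⟨ Sum.Σ-congʳ (_⊆? V G ∩ ∁ A) (λ L L⊆ →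
           let L⊆∁ : L ⊆ ∁ A
               L⊆∁ x∈ = p∩q⊆q (V G) (∁ A) (L⊆ x∈)
           in cong₂ ℤ._*_
             (trans (cong (λ S → sa (G ∣ᴳ S)) (∪∩ K⊆A L⊆∁)) (sym (sa-≃ (∣ᴳ-∣ᴳ-⊆ G K⊆A))))
             (trans (cong (λ S → sa (G ∣ᴳ S)) (∪∩∁ K⊆A L⊆∁)) (sym (sa-≃ (∣ᴳ-∣ᴳ-⊆ G L⊆∁))))) ⟩
    ∑ℤ (_⊆? V G ∩ ∁ A) (λ L → sa (G ∣ᴳ A ∣ᴳ K) ℤ.* sa (G ∣ᴳ ∁ A ∣ᴳ L))
      ≡⟨ ∑ℤ-*ˡ (_⊆? V G ∩ ∁ A) (sa (G ∣ᴳ A ∣ᴳ K)) (λ L → sa (G ∣ᴳ ∁ A ∣ᴳ L)) ⟩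
    sa (G ∣ᴳ A ∣ᴳ K) ℤ.* b (G ∣ᴳ ∁ A)
      ∎
    where
    K⊆A : K ⊆ A
    K⊆A x∈ = p∩q⊆q (V G) A (K⊆ x∈)

-- The counterpart of `sa-odd-part`: an even component kills `b` as an odd one kills `sa`.
b-even-part : (G : Graph n) → Closed G A → Connected (G ∣ᴳ A) → Nonempty (V G ∩ A) → 2 ∣ ∣ V G ∩ A ∣ → b G ≡ + 0
b-even-part {A = A} G A-closed c ne even = trans (b-split G A-closed)
  (trans (cong (ℤ._* b (G ∣ᴳ ∁ A)) (b-even (G ∣ᴳ A) ne c even)) (ℤ.*-zeroˡ (b (G ∣ᴳ ∁ A))))

-- Restriction to sets with only even components

rc : Graph n → Subset n → Graph n
rc = reconnectedComplement

ec-≃ : J ⊆ V H → G ∣ᴳ J ≃ H ∣ᴳ J → EC G J → EC H J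
ec-≃ J⊆V eq (_ , no-odd) = J⊆V , λ (C , C-comp , C-odd) → no-odd (C , isComponent-≃ (≃-sym eq) C-comp , C-odd)

ec-∣ᴳ : (G : Graph n) → EC (G ∣ᴳ I) J ⇔ (EC G J × J ⊆ I)
ec-∣ᴳ {I = I} {J = J} G = mk⇔ forth back
  where
  forth : EC (G ∣ᴳ I) J → EC G J × J ⊆ I
  forth ec@(J⊆V∩I , _) = ec-≃ {H = G} {G = G ∣ᴳ I} (λ x∈ → p∩q⊆p (V G) I (J⊆V∩I x∈)) (∣ᴳ-∣ᴳ-⊆ G J⊆I) ec , J⊆I
    where
    J⊆I : J ⊆ I
    J⊆I x∈ = p∩q⊆q (V G) I (J⊆V∩I x∈)
  back : EC G J × J ⊆ I → EC (G ∣ᴳ I) J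
  back (ec@(J⊆V , _) , J⊆I) =
    ec-≃ {H = G ∣ᴳ I} {G = G} (λ x∈ → x∈p∩q⁺ (J⊆V x∈ , J⊆I x∈)) (≃-sym (∣ᴳ-∣ᴳ-⊆ G J⊆I)) ec

ec-component-even : (G : Graph n) → EC G J → x ∈ J → 2 ∣ ∣ V (G ∣ᴳ J) ∩ component (G ∣ᴳ J) x ∣
ec-component-even {J = J} {x = x} G (J⊆V , no-odd) x∈J = subst (λ S → 2 ∣ ∣ S ∣) (sym V∩C)
  (decidable-stable (2 ∣? _) λ odd → no-odd (component (G ∣ᴳ J) x , isComponent-component (G ∣ᴳ J) x∈V , odd))
  where
  x∈V : x ∈ V G ∩ J
  x∈V = x∈p∩q⁺ (J⊆V x∈J , x∈J)
  V∩C : V (G ∣ᴳ J) ∩ component (G ∣ᴳ J) x ≡ component (G ∣ᴳ J) x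
  V∩C = ⊆-antisym (p∩q⊆q (V (G ∣ᴳ J)) _) (λ y∈ → x∈p∩q⁺ (component⊆V (G ∣ᴳ J) x∈V y∈ , y∈))

b-ec : (G : Graph n) → EC G J → x ∈ J → b (G ∣ᴳ J) ≡ + 0
b-ec {J = J} {x = x} G ec x∈J = b-even-part (G ∣ᴳ J) (component-closed (G ∣ᴳ J) x) (component-connected (G ∣ᴳ J) x)
  (x , x∈p∩q⁺ (x∈p∩q⁺ (proj₁ ec x∈J , x∈J) , x∈component (G ∣ᴳ J) x)) (ec-component-even G ec x∈J)

-- Adding at most one edge

-- Unlike _+ᴳ_, this relation is inherited by induced subgraphs even if they
-- miss u or v.

infix 4 _⊑[_,_]_

record _⊑[_,_]_ (G : Graph n) (u v : Fin n) (H : Graph n) : Set where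
  field
    same-V : V G ≡ V H
    keep   : Adj G x y → Adj H x y
    new    : Adj H x y → Adj G x y ⊎ (x ≡ u × y ≡ v) ⊎ (x ≡ v × y ≡ u)

open _⊑[_,_]_

⊑-∣ᴳ : (I : Subset n) → G ⊑[ u , v ] H → G ∣ᴳ I ⊑[ u , v ] H ∣ᴳ I
⊑-∣ᴳ I E = record
  { same-V = cong (_∩ I) (same-V E)
  ; keep   = λ (r , x∈ , y∈) → keep E r , x∈ , y∈
  ; new    = λ (r , x∈ , y∈) → ⊎.map₁ (λ r′ → r′ , x∈ , y∈) (new E r)
  }

⊑-≃ : G ⊑[ u , v ] H → u ∉ V G → G ≃ H
⊑-≃ {G = G} {u = u} {v = v} {H = H} E u∉ = record { V≡ = same-V E ; ~⇒ = keep E ; ~⇐ = λ r → old r (new E r) }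
  where
  u∉H : u ∉ V H
  u∉H = u∉ ∘ subst (u ∈_) (sym (same-V E))
  old : Adj H x y → Adj G x y ⊎ (x ≡ u × y ≡ v) ⊎ (x ≡ v × y ≡ u) → Adj G x y
  old r (inj₁ r′)                = r′
  old r (inj₂ (inj₁ (refl , _))) = contradiction (Graph.~⇒∈ H r) u∉H
  old r (inj₂ (inj₂ (_ , refl))) = contradiction (Graph.~⇒∈ H (Graph.~-sym H r)) u∉H

-- Cut the path where it first uses the new edge; what precedes is a path in `G` ending at `u` or
-- `v`.
⊑-path : G ⊑[ u , v ] H → Path H x u → Path G x u ⊎ Path G x v
⊑-path E ε = inj₁ ε
⊑-path E (r ◅ p) with new E r
... | inj₂ (inj₁ (refl , _)) = inj₁ ε
... | inj₂ (inj₂ (refl , _)) = inj₂ ε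
... | inj₁ r′ with ⊑-path E p
...   | inj₁ q = inj₁ (r′ ◅ q)
...   | inj₂ q = inj₂ (r′ ◅ q)

record Bisection (G : Graph n) : Set where
  field
    part         : Subset n
    part-closed  : Closed G part
    connectedˡ   : Connected (G ∣ᴳ part)
    connectedʳ   : Connected (G ∣ᴳ ∁ part)

open Bisection

-- By `⊑-path` every vertex still reaches `u` or `v` in `G`. If these two are joined, `G` is
-- connected; otherwise all vertices off the component of `u` are joined to `v`.
connected-or-bisected : G ⊑[ u , v ] H → Connected H → u ∈ V G →
  Connected G ⊎ ∃ λ (B : Bisection G) → u ∈ part B × v ∉ part B
connected-or-bisected {G = G} {u = u} {v = v} {H = H} E H-conn u∈ with path? G u v
... | yes u⇝v = inj₁ λ x y x∈ y∈ → toU x∈ ◅◅ path-sym G (toU y∈)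
  where
  toU : x ∈ V G → Path G x u
  toU {x = x} x∈ with ⊑-path E (H-conn x u (subst (x ∈_) (same-V E) x∈) (subst (u ∈_) (same-V E) u∈))
  ... | inj₁ p = p
  ... | inj₂ p = p ◅◅ path-sym G u⇝v
... | no ¬u⇝v = inj₂ (record
  { part        = component G u
  ; part-closed = component-closed G u
  ; connectedˡ  = component-connected G u
  ; connectedʳ  = λ x y x∈ y∈ → toV x∈ ◅◅ path-sym (G ∣ᴳ ∁ (component G u)) (toV y∈)
  } , x∈component G u , ¬u⇝v ∘ to (∈-component G))
  where
  toV : x ∈ V (G ∣ᴳ ∁ (component G u)) → Path (G ∣ᴳ ∁ (component G u)) x v
  toV {x = x} x∈ with x∈p∩q⁻ (V G) (∁ (component G u)) x∈
  ... | x∈V , x∈∁ with ⊑-path E (H-conn x u (subst (x ∈_) (same-V E) x∈V) (subst (u ∈_) (same-V E) u∈))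
  ...   | inj₁ p = contradiction (from (∈-component G) (path-sym G p)) (x∈∁p⇒x∉p x∈∁)
  ...   | inj₂ p = path-restrict G (closed-∁ G (component-closed G u)) x∈∁ p

Gain : Graph n → Graph n → Pred (Subset n) 0ℓ
Gain G H J = EC H J × ¬ EC G J

gain? : (G H : Graph n) → Decidable (Gain G H)
gain? G H J = ec? H J ×-dec ¬? (ec? G J)

-- Membership of `J` in `EC` depends only on the subgraph on `J`, which is the same inside every `I`
-- containing `J`.
gain-∣ᴳ : (G H : Graph n) (I J : Subset n) → Gain (G ∣ᴳ I) (H ∣ᴳ I) J ⇔ (Gain G H J × J ⊆ I)
gain-∣ᴳ G H I J = mk⇔ forth back
  where
  forth : Gain (G ∣ᴳ I) (H ∣ᴳ I) J → Gain G H J × J ⊆ I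
  forth (ecH , ¬ecG) = (proj₁ (to (ec-∣ᴳ H) ecH) , λ ecG → ¬ecG (from (ec-∣ᴳ G) (ecG , J⊆I))) , J⊆I
    where
    J⊆I : J ⊆ I
    J⊆I = proj₂ (to (ec-∣ᴳ H) ecH)
  back : Gain G H J × J ⊆ I → Gain (G ∣ᴳ I) (H ∣ᴳ I) J
  back ((ecH , ¬ecG) , J⊆I) = from (ec-∣ᴳ H) (ecH , J⊆I) , λ ecG → ¬ecG (proj₁ (to (ec-∣ᴳ G) ecG))

-- A set that misses `u` induces the same subgraph in both graphs, so it cannot be gained.
gain⇒∋u : G ⊑[ u , v ] H → Gain G H J → u ∈ J
gain⇒∋u {G = G} {u = u} {H = H} {J = J} E (ecH , ¬ecG) with u ∈? J
... | yes u∈J = u∈J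
... | no  u∉J = contradiction
      (ec-≃ {H = G} {G = H} (λ {x} x∈ → subst (x ∈_) (sym (same-V E)) (proj₁ ecH x∈))
        (≃-sym (⊑-≃ (⊑-∣ᴳ J E) (u∉J ∘ p∩q⊆q (V G) J))) ecH) ¬ecG

-- The component of `w` in `H ∣ᴳ J` is even and misses `u`, so the new edge is not in it and it is
-- an even component of `G ∣ᴳ J` as well.
b-far : G ⊑[ u , v ] H → EC H J → w ∈ J → ¬ Path (H ∣ᴳ J) w u → b (G ∣ᴳ J) ≡ + 0
b-far {G = G} {u = u} {H = H} {J = J} {w = w} E ec w∈J ¬w⇝u = b-even-part (G ∣ᴳ J) C-closed C-connected
  (w , x∈p∩q⁺ (x∈p∩q⁺ (subst (w ∈_) (sym (same-V E)) (proj₁ ec w∈J) , w∈J) , x∈component (H ∣ᴳ J) w))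
  (subst (λ S → 2 ∣ ∣ S ∩ C ∣) (sym (same-V E′)) (ec-component-even H ec w∈J))
  where
  C : Subset _
  C = component (H ∣ᴳ J) w
  E′ : G ∣ᴳ J ⊑[ _ , _ ] H ∣ᴳ J
  E′ = ⊑-∣ᴳ J E
  C-closed : Closed (G ∣ᴳ J) C
  C-closed r = component-closed (H ∣ᴳ J) w (keep E′ r)
  C-connected : Connected (G ∣ᴳ J ∣ᴳ C)
  C-connected = connected-≃ (≃-sym (⊑-≃ (⊑-∣ᴳ C E′) λ u∈ → ¬w⇝u (to (∈-component (H ∣ᴳ J)) (p∩q⊆q (V (G ∣ᴳ J)) C u∈))))
    (component-connected (H ∣ᴳ J) w)

OddBisection : Graph n → Set
OddBisection G = ∃ λ (B : Bisection G) → (¬ 2 ∣ ∣ V G ∩ part B ∣) × (¬ 2 ∣ ∣ V G ∩ ∁ (part B) ∣)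

oddBisection⇒even : (G : Graph n) → OddBisection G → 2 ∣ ∣ V G ∣
oddBisection⇒even G (B , oddˡ , oddʳ) = subst (2 ∣_) (∣p∩q∣+∣p∩∁q∣≡∣p∣ (V G) (part B)) (odd+odd oddˡ oddʳ)

-- If some vertex of `J` does not reach `u` in `H ∣ᴳ J`, `b-far` applies. Otherwise `H ∣ᴳ J` is
-- connected of even order, and dropping the edge leaves one even piece or two pieces of equal
-- parity; even pieces make `b` vanish.
gain-cases : G ⊑[ u , v ] H → Gain G H J → b (G ∣ᴳ J) ≡ + 0 ⊎ OddBisection (G ∣ᴳ J)
gain-cases {G = G} {u = u} {v = v} {H = H} {J = J} E gain@(ecH , _)
  with Fin.any? (λ w → w ∈? J ×-dec ¬? (path? (H ∣ᴳ J) w u))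
... | yes (w , w∈J , ¬w⇝u) = inj₁ (b-far E ecH w∈J ¬w⇝u)
... | no  ¬far = cases (connected-or-bisected E′ H-conn u∈V)
  where
  E′ : G ∣ᴳ J ⊑[ u , v ] H ∣ᴳ J
  E′ = ⊑-∣ᴳ J E
  u∈J : u ∈ J
  u∈J = gain⇒∋u E gain
  u∈V : u ∈ V (G ∣ᴳ J)
  u∈V = x∈p∩q⁺ (subst (u ∈_) (sym (same-V E)) (proj₁ ecH u∈J) , u∈J)
  toU : x ∈ V (H ∣ᴳ J) → Path (H ∣ᴳ J) x u
  toU {x = x} x∈ = decidable-stable (path? (H ∣ᴳ J) x u) λ ¬p → ¬far (x , p∩q⊆q (V H) J x∈ , ¬p)
  H-conn : Connected (H ∣ᴳ J)
  H-conn x y x∈ y∈ = toU x∈ ◅◅ path-sym (H ∣ᴳ J) (toU y∈)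
  even : 2 ∣ ∣ V (G ∣ᴳ J) ∣
  even = subst (λ S → 2 ∣ ∣ S ∣) (trans (cong (V (H ∣ᴳ J) ∩_) C≡V) (trans (∩-idem _) (sym (same-V E′)))) (ec-component-even H ecH u∈J)
    where
    C≡V : component (H ∣ᴳ J) u ≡ V (H ∣ᴳ J)
    C≡V = to (connected⇒isComponent (H ∣ᴳ J) (u , subst (u ∈_) (same-V E′) u∈V) H-conn _)
             (isComponent-component (H ∣ᴳ J) (subst (u ∈_) (same-V E′) u∈V))
  cases : Connected (G ∣ᴳ J) ⊎ (∃ λ (B : Bisection (G ∣ᴳ J)) → u ∈ part B × v ∉ part B) → _
  cases (inj₁ conn) = inj₁ (b-even (G ∣ᴳ J) (u , u∈V) conn even)
  cases (inj₂ (B , u∈B , _)) with 2 ∣? ∣ V (G ∣ᴳ J) ∩ part B ∣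
  ... | yes even-part = inj₁ (b-even-part (G ∣ᴳ J) (part-closed B) (connectedˡ B) (u , x∈p∩q⁺ (u∈V , u∈B)) even-part)
  -- The total order is even, so the side of `v` is odd together with the side of `u`.
  ... | no odd = inj₂ (B , odd , λ evenʳ → odd (∣m+n∣m⇒∣n
          (subst (2 ∣_) (trans (sym (∣p∩q∣+∣p∩∁q∣≡∣p∣ (V (G ∣ᴳ J)) (part B))) (ℕ.+-comm ∣ V (G ∣ᴳ J) ∩ part B ∣ _)) even) evenʳ))

-- Reconnected complements

-- The paths that define an edge between vertices of `I` run inside `J` and these two vertices,
-- hence inside `I`.
rc-∣ᴳ : (H : Graph n) → J ⊆ I → rc (H ∣ᴳ I) J ≃ rc H J ∣ᴳ I
rc-∣ᴳ {J = J} {I} H J⊆I = record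
  { V≡ = subset-ext λ x → mk⇔
      (λ x∈ → let xV , xI = vertex⇒ x∈ in x∈p∩q⁺ (xV , xI))
      (λ x∈ → let xV , xI = x∈p∩q⁻ (V H ─ J) I x∈ in vertex⇐ xV xI)
  ; ~⇒ = λ (x∈ , y∈ , x≢y , p) → let xV , xI = vertex⇒ x∈ ; yV , yI = vertex⇒ y∈ in
      (xV , yV , x≢y , Star.map (λ ((r , _) , x∈ , y∈) → r , x∈ , y∈) p) , xI , yI
  ; ~⇐ = λ ((x∈ , y∈ , x≢y , p) , xI , yI) → vertex⇐ x∈ xI , vertex⇐ y∈ yI , x≢y ,
      Star.map (λ (r , x∈ , y∈) → (r , inside-I xI yI x∈ , inside-I xI yI y∈) , x∈ , y∈) p
  }
  where
  vertex⇒ : x ∈ V H ∩ I ─ J → x ∈ V H ─ J × x ∈ I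
  vertex⇒ x∈ = let x∈∩ , x∉J = to x∈p─q⇔ x∈ ; x∈V , x∈I = x∈p∩q⁻ (V H) I x∈∩ in from x∈p─q⇔ (x∈V , x∉J) , x∈I
  vertex⇐ : x ∈ V H ─ J → x ∈ I → x ∈ V H ∩ I ─ J
  vertex⇐ x∈ x∈I = let x∈V , x∉J = to x∈p─q⇔ x∈ in from x∈p─q⇔ (x∈p∩q⁺ (x∈V , x∈I) , x∉J)
  inside-I : x ∈ I → y ∈ I → w ∈ J ∪ (⁅ x ⁆ ∪ ⁅ y ⁆) → w ∈ I
  inside-I {x = x} {y = y} xI yI w∈ with x∈p∪q⁻ J _ w∈
  ... | inj₁ w∈J = J⊆I w∈J
  ... | inj₂ w∈′ with x∈p∪q⁻ ⁅ x ⁆ ⁅ y ⁆ w∈′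
  ...   | inj₁ w∈x rewrite x∈⁅y⁆⇒x≡y x w∈x = xI
  ...   | inj₂ w∈y rewrite x∈⁅y⁆⇒x≡y y w∈y = yI

∈-via : (J : Subset n) (x y : Fin n) → w ∈ J ∪ (⁅ x ⁆ ∪ ⁅ y ⁆) ⇔ (w ∈ J ⊎ w ≡ x ⊎ w ≡ y)
∈-via {w = w} J x y = mk⇔ forth back
  where
  forth : w ∈ J ∪ (⁅ x ⁆ ∪ ⁅ y ⁆) → w ∈ J ⊎ w ≡ x ⊎ w ≡ y
  forth w∈ with x∈p∪q⁻ J _ w∈
  ... | inj₁ w∈J = inj₁ w∈J
  ... | inj₂ w∈′ with x∈p∪q⁻ ⁅ x ⁆ ⁅ y ⁆ w∈′
  ...   | inj₁ w∈x = inj₂ (inj₁ (x∈⁅y⁆⇒x≡y x w∈x))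
  ...   | inj₂ w∈y = inj₂ (inj₂ (x∈⁅y⁆⇒x≡y y w∈y))
  back : w ∈ J ⊎ w ≡ x ⊎ w ≡ y → w ∈ J ∪ (⁅ x ⁆ ∪ ⁅ y ⁆)
  back (inj₁ w∈J)         = p⊆p∪q _ w∈J
  back (inj₂ (inj₁ refl)) = q⊆p∪q J _ (p⊆p∪q _ (x∈⁅x⁆ w))
  back (inj₂ (inj₂ refl)) = q⊆p∪q J _ (q⊆p∪q _ _ (x∈⁅x⁆ w))

-- Skipping the visits to `J`, a walk in `H` becomes a walk in `rc H J`. The current segment is kept
-- for every possible far end `t`, because its host graph depends on an end that is known only when
-- the walk leaves `J`.
rc-connected : (H : Graph n) (J : Subset n) → Connected H → Connected (rc H J)
rc-connected H J H-conn x y x∈ y∈ =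
  walk x∈ (inj₂ refl) ε (H-conn x y (p─q⊆p (V H) J x∈) (p─q⊆p (V H) J y∈))
  where
  -- z is the last vertex outside J met by the walk, c its current vertex.
  walk : ∀ {z c} → z ∈ V H ─ J → c ∈ J ⊎ c ≡ z → (∀ {t} → Path (H ∣ᴳ (J ∪ (⁅ z ⁆ ∪ ⁅ t ⁆))) z c) →
    Path H c y → Path (rc H J) z y
  walk z∈ (inj₁ c∈J) q ε    = contradiction c∈J (x∈p─q⇒x∉q (V H) J y∈)
  walk z∈ (inj₂ refl) q ε   = ε
  walk {z} {c} z∈ c∈ q (_◅_ {j = d} r p) with d ∈? J | d Fin.≟ z
  ... | yes d∈J | _ = walk z∈ (inj₁ d∈J) (λ {t} → q ◅◅ (r , from (∈-via J z t) (⊎.map₂ inj₁ c∈) , from (∈-via J z t) (inj₁ d∈J)) ◅ ε) p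
  -- The walk is back at `z`: a loop is no edge, so the segment starts afresh.
  ... | no  d∉J | yes refl = walk z∈ (inj₂ refl) ε p
  ... | no  d∉J | no d≢z =
    (z∈ , d∈ , d≢z ∘ sym , q ◅◅ (r , from (∈-via J z d) (⊎.map₂ inj₁ c∈) , from (∈-via J z d) (inj₂ (inj₂ refl))) ◅ ε)
    ◅ walk d∈ (inj₂ refl) ε p
    where
    d∈ : d ∈ V H ─ J
    d∈ = from x∈p─q⇔ (Graph.~⇒∈ H (Graph.~-sym H r) , d∉J)

rc-closed : (H : Graph n) → Closed H A → Closed (rc H J) A
rc-closed H A-closed (_ , _ , _ , p) = path-closed H A-closed (Star.map proj₁ p)

-- Makes the factor of `sa (rc H J)` off `A` independent of `J`, so that it can be pulled out of a
-- sum over `J ⊆ A`.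
rc-outside : (H : Graph n) → Closed H A → J ⊆ A → rc H J ∣ᴳ ∁ A ≃ H ∣ᴳ ∁ A
rc-outside {A = A} {J = J} H A-closed J⊆A = record
  { V≡ = subset-ext λ x → mk⇔
      (λ x∈ → let x∈─ , x∈∁ = x∈p∩q⁻ (V H ─ J) (∁ A) x∈ in x∈p∩q⁺ (p─q⊆p (V H) J x∈─ , x∈∁))
      (λ x∈ → let x∈V , x∈∁ = x∈p∩q⁻ (V H) (∁ A) x∈ in x∈p∩q⁺ (from x∈p─q⇔ (x∈V , outside-J x∈∁) , x∈∁))
  ; ~⇒ = λ ((_ , _ , x≢y , p) , x∈ , y∈) → first-step x∈ x≢y p , x∈ , y∈
  ; ~⇐ = λ {x} {y} (r , x∈ , y∈) →
      ( from x∈p─q⇔ (Graph.~⇒∈ H r , outside-J x∈)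
      , from x∈p─q⇔ (Graph.~⇒∈ H (Graph.~-sym H r) , outside-J y∈)
      , (λ x≡y → Graph.~-irrefl H x≡y r)
      , (r , from (∈-via J x y) (inj₂ (inj₁ refl)) , from (∈-via J x y) (inj₂ (inj₂ refl))) ◅ ε)
      , x∈ , y∈
  }
  where
  outside-J : x ∈ ∁ A → x ∉ J
  outside-J x∈∁ x∈J = x∈∁p⇒x∉p x∈∁ (J⊆A x∈J)
  -- The walk cannot enter J from outside A, so its first step leads to y.
  first-step : x ∈ ∁ A → x ≢ y → Path (H ∣ᴳ (J ∪ (⁅ x ⁆ ∪ ⁅ y ⁆))) x y → Adj H x y
  first-step x∈∁ x≢y ε = contradiction refl x≢y
  first-step {x = x} {y = y} x∈∁ x≢y ((r , _ , w∈) ◅ _) with to (∈-via J x y) w∈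
  ... | inj₁ w∈J         = contradiction w∈J (outside-J (closed-∁ H A-closed r x∈∁))
  ... | inj₂ (inj₁ refl) = contradiction r (Graph.~-irrefl H refl)
  ... | inj₂ (inj₂ refl) = r

⊈⇒∃ : ¬ J ⊆ I → ∃ λ x → x ∈ J × x ∉ I
⊈⇒∃ {J = J} {I = I} J⊈I with nonempty? (J ─ I)
... | yes (x , x∈) = x , to x∈p─q⇔ x∈
... | no  e        = contradiction (λ {x} x∈J → decidable-stable (x ∈? I) λ x∉I → e (x , from x∈p─q⇔ (x∈J , x∉I))) J⊈I

-- The interval from `J` to the larger set corresponds to the subsets of the difference, in the form
-- that `Σ-reindex` takes.
interval⇔ : J ⊆ A → ∀ I K → ((J ⊆ I × I ⊆ A) × K ≡ I ─ J) ⇔ (K ⊆ A ─ J × I ≡ J ∪ K)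
interval⇔ {J = J} {A = W} J⊆W I K = mk⇔ forth back
  where
  forth : (J ⊆ I × I ⊆ W) × K ≡ I ─ J → K ⊆ W ─ J × I ≡ J ∪ K
  forth ((J⊆I , I⊆W) , refl) =
    (λ x∈ → let xI , x∉J = to x∈p─q⇔ x∈ in from x∈p─q⇔ (I⊆W xI , x∉J)) , subset-ext λ x → mk⇔ split merge
    where
    split : x ∈ I → x ∈ J ∪ (I ─ J)
    split {x = x} x∈I with x ∈? J
    ... | yes x∈J = p⊆p∪q _ x∈J
    ... | no  x∉J = q⊆p∪q J _ (from x∈p─q⇔ (x∈I , x∉J))
    merge : x ∈ J ∪ (I ─ J) → x ∈ I
    merge x∈ with x∈p∪q⁻ J _ x∈
    ... | inj₁ x∈J = J⊆I x∈J
    ... | inj₂ x∈─ = proj₁ (to x∈p─q⇔ x∈─)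
  back : K ⊆ W ─ J × I ≡ J ∪ K → (J ⊆ I × I ⊆ W) × K ≡ I ─ J
  back (K⊆ , refl) = (p⊆p∪q K , upper) , subset-ext λ x → mk⇔
      (λ xK → from x∈p─q⇔ (q⊆p∪q J K xK , proj₂ (to x∈p─q⇔ (K⊆ xK)))) lower
    where
    upper : J ∪ K ⊆ W
    upper x∈ with x∈p∪q⁻ J K x∈
    ... | inj₁ xJ = J⊆W xJ
    ... | inj₂ xK = proj₁ (to x∈p─q⇔ (K⊆ xK))
    lower : x ∈ (J ∪ K) ─ J → x ∈ K
    lower x∈ with to x∈p─q⇔ x∈
    ... | x∈∪ , x∉J with x∈p∪q⁻ J K x∈∪
    ...   | inj₁ xJ = contradiction xJ x∉J
    ...   | inj₂ xK = xK

∣q∣+∣p─q∣≡∣p∣ : J ⊆ I → ∣ J ∣ + ∣ I ─ J ∣ ≡ ∣ I ∣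
∣q∣+∣p─q∣≡∣p∣ {J = J} {I = I} J⊆I = trans (cong₂ (λ S T → ∣ S ∣ + ∣ T ∣) J≡ ─≡) (∣p∩q∣+∣p∩∁q∣≡∣p∣ I J)
  where
  J≡ : J ≡ I ∩ J
  J≡ = ⊆-antisym (λ x∈ → x∈p∩q⁺ (J⊆I x∈ , x∈)) (p∩q⊆q I J)
  ─≡ : I ─ J ≡ I ∩ ∁ J
  ─≡ = subset-ext λ x → mk⇔
    (λ x∈ → let xI , x∉J = to x∈p─q⇔ x∈ in x∈p∩q⁺ (xI , x∉p⇒x∈∁p x∉J))
    (λ x∈ → let xI , x∈∁ = x∈p∩q⁻ I (∁ J) x∈ in from x∈p─q⇔ (xI , x∈∁p⇒x∉p x∈∁))

rc-∪ : (H : Graph n) (J K : Subset n) → rc H J ∣ᴳ (J ∪ K) ≃ rc H J ∣ᴳ K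
rc-∪ H J K = ∣ᴳ-cong (≃-refl (rc H J)) λ x∈ → mk⇔
  (λ x∈∪ → case x∈p∪q⁻ J K x∈∪ of λ { (inj₁ xJ) → contradiction xJ (proj₂ (to x∈p─q⇔ x∈)) ; (inj₂ xK) → xK })
  (q⊆p∪q J K)

-- The signed recursion

*-distribʳ-minus : ∀ k i j → (i ℤ.- j) ℤ.* k ≡ i ℤ.* k ℤ.- j ℤ.* k
*-distribʳ-minus k i j = trans (ℤ.*-distribʳ-+ k i (ℤ.- j)) (cong (ℤ._+_ (i ℤ.* k)) (sym (ℤ.neg-distribˡ-* j k)))

i+j≡0⇒-j≡i : ∀ i j → i ℤ.+ j ≡ + 0 → ℤ.- j ≡ i
i+j≡0⇒-j≡i i j i+j≡0 = begin
  ℤ.- j                  ≡⟨ ℤ.+-identityˡ (ℤ.- j) ⟨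
  + 0 ℤ.+ ℤ.- j          ≡⟨ cong (ℤ._- j) i+j≡0 ⟨
  (i ℤ.+ j) ℤ.- j        ≡⟨ ℤ.+-assoc i j (ℤ.- j) ⟩
  i ℤ.+ (j ℤ.- j)        ≡⟨ cong (ℤ._+_ i) (ℤ.+-inverseʳ j) ⟩
  i ℤ.+ + 0              ≡⟨ ℤ.+-identityʳ i ⟩
  i                      ∎
  where open ≡-Reasoning

gain⇒⊆V : G ⊑[ u , v ] H → Gain G H J → J ⊆ V G
gain⇒⊆V E (ecH , _) {x} x∈J = subst (x ∈_) (sym (same-V E)) (proj₁ ecH x∈J)

gain⇒V∩ : G ⊑[ u , v ] H → Gain G H J → V G ∩ J ≡ J
gain⇒V∩ {G = G} {J = J} E gain = ⊆-antisym (p∩q⊆q (V G) J) (λ x∈ → x∈p∩q⁺ (gain⇒⊆V E gain x∈ , x∈))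

gain-odd-bisection⇒even : G ⊑[ u , v ] H → Gain G H J → OddBisection (G ∣ᴳ J) → 2 ∣ ∣ J ∣
gain-odd-bisection⇒even {G = G} {J = J} E gain odd = subst (λ S → 2 ∣ ∣ S ∣) (gain⇒V∩ E gain) (oddBisection⇒even (G ∣ᴳ J) odd)

SaRecursion : Graph n → Graph n → Set
SaRecursion G H = sa H ≡ sa G ℤ.- ∑ℤ (gain? G H) (λ J → b (G ∣ᴳ J) ℤ.* sa (rc H J))

-- Rewrites the identity on `I` with the gained sets and complements of the whole pair `G`, `H`, so
-- that the identities for different `I` can be added up.
sa-gain-∣ᴳ : (G H : Graph n) (I : Subset n) → SaRecursion (G ∣ᴳ I) (H ∣ᴳ I) →
  sa (H ∣ᴳ I) ≡ sa (G ∣ᴳ I) ℤ.- ∑ℤ (λ J → gain? G H J ×-dec J ⊆? I) (λ J → b (G ∣ᴳ J) ℤ.* sa (rc H J ∣ᴳ I))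
sa-gain-∣ᴳ G H I eq = trans eq (cong (ℤ._-_ (sa (G ∣ᴳ I)))
  (Sum.Σ-cong (gain? (G ∣ᴳ I) (H ∣ᴳ I)) (λ J → gain? G H J ×-dec J ⊆? I) (gain-∣ᴳ G H I) inner))
  where
  inner : ∀ J → Gain (G ∣ᴳ I) (H ∣ᴳ I) J →
    b (G ∣ᴳ I ∣ᴳ J) ℤ.* sa (rc (H ∣ᴳ I) J) ≡ b (G ∣ᴳ J) ℤ.* sa (rc H J ∣ᴳ I)
  inner J gain = cong₂ ℤ._*_ (b-≃ (∣ᴳ-∣ᴳ-⊆ G J⊆I)) (sa-≃ (rc-∣ᴳ H J⊆I))
    where
    J⊆I : J ⊆ I
    J⊆I = proj₂ (to (gain-∣ᴳ G H I J) gain)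

-- For fixed `J`, the sets `I` between `J` and `V H` are the sets `J ∪ K` with `K` in `rc H J`, so
-- the inner sum is `b (rc H J)`.
gain-∑ : (G H : Graph n) →
  ∑ℤ (_⊆? V H) (λ I → ∑ℤ (λ J → gain? G H J ×-dec J ⊆? I) (λ J → b (G ∣ᴳ J) ℤ.* sa (rc H J ∣ᴳ I)))
  ≡ ∑ℤ (gain? G H) (λ J → b (G ∣ᴳ J) ℤ.* b (rc H J))
gain-∑ G H = begin
  ∑ℤ (_⊆? V H) (λ I → ∑ℤ (λ J → gain? G H J ×-dec J ⊆? I) (λ J → b (G ∣ᴳ J) ℤ.* sa (rc H J ∣ᴳ I)))
    ≡⟨ Sum.Σ-swap (_⊆? V H) (λ I J → gain? G H J ×-dec J ⊆? I) (λ J I → J ⊆? I ×-dec I ⊆? V H) (gain? G H)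
         (λ I J → b (G ∣ᴳ J) ℤ.* sa (rc H J ∣ᴳ I)) rearrange ⟩
  ∑ℤ (gain? G H) (λ J → ∑ℤ (λ I → J ⊆? I ×-dec I ⊆? V H) (λ I → b (G ∣ᴳ J) ℤ.* sa (rc H J ∣ᴳ I)))
    ≡⟨ Sum.Σ-congʳ (gain? G H) inner ⟩
  ∑ℤ (gain? G H) (λ J → b (G ∣ᴳ J) ℤ.* b (rc H J))
    ∎
  where
  open ≡-Reasoning
  rearrange : ∀ I J → (I ⊆ V H × Gain G H J × J ⊆ I) ⇔ (Gain G H J × J ⊆ I × I ⊆ V H)
  rearrange I J = mk⇔ forth back
    where
    forth : I ⊆ V H × Gain G H J × J ⊆ I → Gain G H J × J ⊆ I × I ⊆ V H
    forth (p , q , r) = q , r , p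
    back : Gain G H J × J ⊆ I × I ⊆ V H → I ⊆ V H × Gain G H J × J ⊆ I
    back (q , r , p) = p , q , r
  inner : ∀ J → Gain G H J →
    ∑ℤ (λ I → J ⊆? I ×-dec I ⊆? V H) (λ I → b (G ∣ᴳ J) ℤ.* sa (rc H J ∣ᴳ I)) ≡ b (G ∣ᴳ J) ℤ.* b (rc H J)
  inner J ((J⊆V , _) , _) = trans
    (∑ℤ-*ˡ (λ I → J ⊆? I ×-dec I ⊆? V H) (b (G ∣ᴳ J)) (λ I → sa (rc H J ∣ᴳ I)))
    (cong (b (G ∣ᴳ J) ℤ.*_) (trans
      (Sum.Σ-reindex (λ I → J ⊆? I ×-dec I ⊆? V H) (_⊆? V H ─ J) (λ I → sa (rc H J ∣ᴳ I)) (J ∪_) (_─ J) (interval⇔ J⊆V))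
      (Sum.Σ-congʳ (_⊆? V H ─ J) (λ K _ → sa-≃ (rc-∪ H J K)))))

sa-gain-degenerate : G ⊑[ u , v ] H → u ∉ V G → SaRecursion G H
sa-gain-degenerate {G = G} {u = u} {H = H} E u∉ = trans (sa-≃ (≃-sym (⊑-≃ E u∉))) (trans (sym (ℤ.+-identityʳ (sa G)))
  (cong (λ s → sa G ℤ.- s) (sym (Sum.Σ-ε (gain? G H) λ J gain → contradiction (gain⇒⊆V E gain (gain⇒∋u E gain)) u∉))))

-- A term with nonzero `b` has `J` even, which leaves a complement of odd order, where `sa`
-- vanishes.
sa-gain-odd : G ⊑[ u , v ] H → ¬ 2 ∣ ∣ V H ∣ → SaRecursion G H
sa-gain-odd {G = G} {H = H} E odd = trans (sa-odd-card H odd) (sym (cong₂ ℤ._-_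
  (sa-odd-card G (subst (λ S → ¬ 2 ∣ ∣ S ∣) (sym (same-V E)) odd)) (Sum.Σ-ε (gain? G H) term)))
  where
  term : ∀ J → Gain G H J → b (G ∣ᴳ J) ℤ.* sa (rc H J) ≡ + 0
  term J gain@((J⊆V , _) , _) with gain-cases E gain
  ... | inj₁ b≡0 = trans (cong (ℤ._* sa (rc H J)) b≡0) (ℤ.*-zeroˡ (sa (rc H J)))
  ... | inj₂ bisection = trans (cong (b (G ∣ᴳ J) ℤ.*_) (sa-odd-card (rc H J) rest-odd)) (ℤ.*-zeroʳ (b (G ∣ᴳ J)))
    where
    rest-odd : ¬ 2 ∣ ∣ V H ─ J ∣
    rest-odd even = odd (subst (2 ∣_) (∣q∣+∣p─q∣≡∣p∣ J⊆V) (∣m∣n⇒∣m+n (gain-odd-bisection⇒even E gain bisection) even))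

-- Off the component `C` of `u` the graphs `G`, `H` and `rc H J` agree for `J ⊆ C`, so one common
-- factor `r` comes out. A gained `J` that leaves `C` has a vertex far from `u` and contributes
-- zero.
sa-gain-disconnected : G ⊑[ u , v ] H → SaRecursion (G ∣ᴳ component H u) (H ∣ᴳ component H u) → SaRecursion G H
sa-gain-disconnected {G = G} {u = u} {H = H} E eq = begin
  sa H
    ≡⟨ sa-split {A = C} H C-closed ⟩
  sa (H ∣ᴳ C) ℤ.* r
    ≡⟨ cong (ℤ._* r) (sa-gain-∣ᴳ G H C eq) ⟩
  (sa (G ∣ᴳ C) ℤ.- ∑ℤ (λ J → gain? G H J ×-dec J ⊆? C) (λ J → b (G ∣ᴳ J) ℤ.* sa (rc H J ∣ᴳ C))) ℤ.* r
    ≡⟨ *-distribʳ-minus r (sa (G ∣ᴳ C)) (∑ℤ (λ J → gain? G H J ×-dec J ⊆? C) (λ J → b (G ∣ᴳ J) ℤ.* sa (rc H J ∣ᴳ C))) ⟩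
  sa (G ∣ᴳ C) ℤ.* r ℤ.- ∑ℤ (λ J → gain? G H J ×-dec J ⊆? C) (λ J → b (G ∣ᴳ J) ℤ.* sa (rc H J ∣ᴳ C)) ℤ.* r
    ≡⟨ cong₂ ℤ._-_ G-part sum-part ⟩
  sa G ℤ.- ∑ℤ (gain? G H) (λ J → b (G ∣ᴳ J) ℤ.* sa (rc H J))
    ∎
  where
  open ≡-Reasoning
  C : Subset _
  C = component H u
  C-closed : Closed H C
  C-closed = component-closed H u
  r : ℤ
  r = sa (H ∣ᴳ ∁ C)
  G-part : sa (G ∣ᴳ C) ℤ.* r ≡ sa G
  G-part = trans
    (cong (sa (G ∣ᴳ C) ℤ.*_) (sa-≃ (≃-sym (⊑-≃ (⊑-∣ᴳ (∁ C) E) (x∉∩∁ {J = V G} (x∈component H u))))))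
    (sym (sa-split G (λ e → C-closed (keep E e))))
  inside-C : ∀ J → Gain G H J → ¬ J ⊆ C → b (G ∣ᴳ J) ℤ.* sa (rc H J) ≡ + 0
  inside-C J (ecH , _) J⊈C = trans (cong (ℤ._* sa (rc H J)) (b-far E ecH w∈J λ p →
    w∉C (from (∈-component H) (path-sym H (Star.map proj₁ p))))) (ℤ.*-zeroˡ (sa (rc H J)))
    where
    outlier : ∃ λ w → w ∈ J × w ∉ C
    outlier = ⊈⇒∃ J⊈C
    w∈J = proj₁ (proj₂ outlier)
    w∉C = proj₂ (proj₂ outlier)
  factor : ∀ J → Gain G H J × J ⊆ C → (b (G ∣ᴳ J) ℤ.* sa (rc H J ∣ᴳ C)) ℤ.* r ≡ b (G ∣ᴳ J) ℤ.* sa (rc H J)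
  factor J (_ , J⊆C) = trans (ℤ.*-assoc (b (G ∣ᴳ J)) (sa (rc H J ∣ᴳ C)) r) (cong (b (G ∣ᴳ J) ℤ.*_) (trans
    (cong (sa (rc H J ∣ᴳ C) ℤ.*_) (sym (sa-≃ (rc-outside H C-closed J⊆C))))
    (sym (sa-split (rc H J) (rc-closed {J = J} H C-closed)))))
  sum-part : ∑ℤ (λ J → gain? G H J ×-dec J ⊆? C) (λ J → b (G ∣ᴳ J) ℤ.* sa (rc H J ∣ᴳ C)) ℤ.* r ≡ ∑ℤ (gain? G H) (λ J → b (G ∣ᴳ J) ℤ.* sa (rc H J))
  sum-part = begin
    ∑ℤ (λ J → gain? G H J ×-dec J ⊆? C) (λ J → b (G ∣ᴳ J) ℤ.* sa (rc H J ∣ᴳ C)) ℤ.* r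
      ≡⟨ ∑ℤ-*ʳ (λ J → gain? G H J ×-dec J ⊆? C) r (λ J → b (G ∣ᴳ J) ℤ.* sa (rc H J ∣ᴳ C)) ⟨
    ∑ℤ (λ J → gain? G H J ×-dec J ⊆? C) (λ J → (b (G ∣ᴳ J) ℤ.* sa (rc H J ∣ᴳ C)) ℤ.* r)
      ≡⟨ Sum.Σ-congʳ (λ J → gain? G H J ×-dec J ⊆? C) factor ⟩
    ∑ℤ (λ J → gain? G H J ×-dec J ⊆? C) (λ J → b (G ∣ᴳ J) ℤ.* sa (rc H J))
      ≡⟨ Sum.Σ-restrict (gain? G H) (_⊆? C) inside-C ⟨
    ∑ℤ (gain? G H) (λ J → b (G ∣ᴳ J) ℤ.* sa (rc H J))
      ∎

b-gain-even : G ⊑[ u , v ] H → u ∈ V G → Connected H → 2 ∣ ∣ V H ∣ →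
  b G ≡ ∑ℤ (gain? G H) (λ J → b (G ∣ᴳ J) ℤ.* b (rc H J))
b-gain-even {G = G} {u = u} {H = H} E u∈ H-conn even = sym (trans (Sum.Σ-restrict (gain? G H) (_≟ˢ V H) proper) total)
  where
  u∈H : u ∈ V H
  u∈H = subst (u ∈_) (same-V E) u∈
  proper : ∀ J → Gain G H J → J ≢ V H → b (G ∣ᴳ J) ℤ.* b (rc H J) ≡ + 0
  proper J gain@((J⊆V , _) , _) J≢V with gain-cases E gain
  ... | inj₁ b≡0 = trans (cong (ℤ._* b (rc H J)) b≡0) (ℤ.*-zeroˡ (b (rc H J)))
  ... | inj₂ bisection = trans (cong (b (G ∣ᴳ J) ℤ.*_) (b-even (rc H J) rest (rc-connected H J H-conn)
          (∣m+n∣m⇒∣n (subst (2 ∣_) (sym (∣q∣+∣p─q∣≡∣p∣ J⊆V)) even) (gain-odd-bisection⇒even E gain bisection))))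
          (ℤ.*-zeroʳ (b (G ∣ᴳ J)))
    where
    rest : Nonempty (V H ─ J)
    rest = let _ , x , x∈V , x∉J = ⊆∧≢⇒⊂ (J⊆V , J≢V) in x , from x∈p─q⇔ (x∈V , x∉J)
  ecV : EC H (V H)
  ecV = id , λ (C , C-comp , C-odd) → C-odd (subst (λ S → 2 ∣ ∣ S ∣)
    (sym (to (connected⇒isComponent H (u , u∈H) H-conn C) (isComponent-≃ (∣ᴳ-⊇ H id) C-comp))) even)
  total : ∑ℤ (λ J → gain? G H J ×-dec J ≟ˢ V H) (λ J → b (G ∣ᴳ J) ℤ.* b (rc H J)) ≡ b G
  total = by-cases (ec? G (V H))
    where
    G∣V : G ∣ᴳ V H ≃ G
    G∣V = ∣ᴳ-⊇ G (λ {x} → subst (x ∈_) (same-V E))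
    by-cases : Dec (EC G (V H)) → ∑ℤ (λ J → gain? G H J ×-dec J ≟ˢ V H) (λ J → b (G ∣ᴳ J) ℤ.* b (rc H J)) ≡ b G
    -- `V H` is not gained, the sum is empty, and `b G` vanishes since all components of `G` are
    -- even.
    by-cases (yes ec) = trans (Sum.Σ-ε (λ J → gain? G H J ×-dec J ≟ˢ V H) (λ { J ((_ , ¬ec) , refl) → contradiction ec ¬ec }))
      (sym (trans (b-≃ (≃-sym G∣V)) (b-ec G ec u∈H)))
    -- `V H` is gained; its complement is the null graph, with `b` equal to 1.
    by-cases (no ¬ec) = trans
      (Sum.Σ-≡ (λ J → gain? G H J ×-dec J ≟ˢ V H) (λ J → b (G ∣ᴳ J) ℤ.* b (rc H J)) (V H) (λ J → mk⇔ proj₂ (λ { refl → (ecV , ¬ec) , refl })))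
      (trans (cong₂ ℤ._*_ (b-≃ G∣V) (b-null (rc H (V H)) λ (x , x∈) → let x∈V , x∉V = to (x∈p─q⇔ {I = V H} {J = V H}) x∈ in x∉V x∈V))
             (ℤ.*-identityʳ (b G)))

-- The right-hand side of the identity on `I`, as rewritten by `sa-gain-∣ᴳ`.
expansion : Graph n → Graph n → Subset n → ℤ
expansion G H I = sa (G ∣ᴳ I) ℤ.- ∑ℤ (λ J → gain? G H J ×-dec J ⊆? I) (λ J → b (G ∣ᴳ J) ℤ.* sa (rc H J ∣ᴳ I))

∑-expansion : G ⊑[ u , v ] H →
  ∑ℤ (_⊆? V H) (expansion G H) ≡ b G ℤ.- ∑ℤ (gain? G H) (λ J → b (G ∣ᴳ J) ℤ.* b (rc H J))
∑-expansion {G = G} {H = H} E = trans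
  (∑ℤ-minus (_⊆? V H) (λ I → sa (G ∣ᴳ I)) (λ I → ∑ℤ (λ J → gain? G H J ×-dec J ⊆? I) (λ J → b (G ∣ᴳ J) ℤ.* sa (rc H J ∣ᴳ I))))
  (cong₂ ℤ._-_ (cong (λ W → ∑ℤ (_⊆? W) (λ I → sa (G ∣ᴳ I))) (sym (same-V E))) (gain-∑ G H))

expansion-V : G ⊑[ u , v ] H →
  expansion G H (V H) ≡ sa G ℤ.- ∑ℤ (gain? G H) (λ J → b (G ∣ᴳ J) ℤ.* sa (rc H J))
expansion-V {G = G} {H = H} E = cong₂ ℤ._-_ (sa-≃ (∣ᴳ-⊇ G (λ {x} → subst (x ∈_) (same-V E))))
  (Sum.Σ-cong (λ J → gain? G H J ×-dec J ⊆? V H) (gain? G H) (λ J → mk⇔ proj₁ (λ gain → gain , proj₁ (proj₁ gain)))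
    (λ J _ → cong (b (G ∣ᴳ J) ℤ.*_) (sa-≃ (∣ᴳ-⊇ (rc H J) (p─q⊆p (V H) J)))))

sa-gain-even : G ⊑[ u , v ] H → u ∈ V G → Connected H → 2 ∣ ∣ V H ∣ →
  (∀ I → I ⊂ V H → SaRecursion (G ∣ᴳ I) (H ∣ᴳ I)) → SaRecursion G H
sa-gain-even {G = G} {u = u} {H = H} E u∈ H-conn even IH = begin
  sa H
    ≡⟨ sa-even H (u , subst (u ∈_) (same-V E) u∈) H-conn even ⟩
  ℤ.- ∑ℤ (_⊂? V H) (λ I → sa (H ∣ᴳ I))
    ≡⟨ cong ℤ.-_ (Sum.Σ-congʳ (_⊂? V H) {λ I → sa (H ∣ᴳ I)} {expansion G H} (λ I I⊂V → sa-gain-∣ᴳ G H I (IH I I⊂V))) ⟩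
  ℤ.- ∑ℤ (_⊂? V H) (expansion G H)
    ≡⟨ i+j≡0⇒-j≡i (expansion G H (V H)) (∑ℤ (_⊂? V H) (expansion G H)) total ⟩
  expansion G H (V H)
    ≡⟨ expansion-V E ⟩
  sa G ℤ.- ∑ℤ (gain? G H) (λ J → b (G ∣ᴳ J) ℤ.* sa (rc H J))
    ∎
  where
  open ≡-Reasoning
  total : expansion G H (V H) ℤ.+ ∑ℤ (_⊂? V H) (expansion G H) ≡ + 0
  total = trans (sym (∑ℤ-⊆ (V H) (expansion G H))) (trans (∑-expansion E)
    (ℤ.i≡j⇒i-j≡0 (b-gain-even E u∈ H-conn even)))

-- Induction on the order of `H` with `G` left general, since the smaller instances are pairs of
-- induced subgraphs. Connectedness is tested by reachability from `u`, which yields the component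
-- for the disconnected case.
sa-gain : G ⊑[ u , v ] H → SaRecursion G H
sa-gain {n} {G = G} {u = u} {v = v} {H = H} = graph-induction (λ H → ∀ G → G ⊑[ u , v ] H → SaRecursion G H) step H G
  where
  step : (H : Graph n) → (∀ K → ∣ V K ∣ < ∣ V H ∣ → ∀ G → G ⊑[ u , v ] K → SaRecursion G K) →
    ∀ G → G ⊑[ u , v ] H → SaRecursion G H
  step H IH G E = by-cases (u ∈? V G) (2 ∣? ∣ V H ∣) (Fin.any? (λ x → x ∈? V H ×-dec ¬? (path? H u x)))
    where
    by-cases : Dec (u ∈ V G) → Dec (2 ∣ ∣ V H ∣) → Dec (∃ λ x → x ∈ V H × ¬ Path H u x) → SaRecursion G H
    by-cases (no u∉)  _          _                       = sa-gain-degenerate E u∉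
    by-cases (yes u∈) (no odd)   _                       = sa-gain-odd E odd
    by-cases (yes u∈) (yes even) (yes (x , x∈ , ¬u⇝x)) = sa-gain-disconnected E
      (IH (H ∣ᴳ component H u) (∣∩∣<∣∣ x∈ (¬u⇝x ∘ to (∈-component H))) (G ∣ᴳ component H u) (⊑-∣ᴳ (component H u) E))
    by-cases (yes u∈) (yes even) (no ¬far) = sa-gain-even E u∈ H-conn even λ I (_ , x , x∈ , x∉) →
      IH (H ∣ᴳ I) (∣∩∣<∣∣ x∈ x∉) (G ∣ᴳ I) (⊑-∣ᴳ I E)
      where
      fromU : x ∈ V H → Path H u x
      fromU {x = x} x∈ = decidable-stable (path? H u x) λ ¬p → ¬far (x , x∈ , ¬p)
      H-conn : Connected H
      H-conn x y x∈ y∈ = path-sym H (fromU x∈) ◅◅ fromU y∈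

b-gain : G ⊑[ u , v ] H → b H ≡ b G ℤ.- ∑ℤ (gain? G H) (λ J → b (G ∣ᴳ J) ℤ.* b (rc H J))
b-gain {G = G} {H = H} E = trans
  (Sum.Σ-congʳ (_⊆? V H) {λ I → sa (H ∣ᴳ I)} {expansion G H} (λ I _ → sa-gain-∣ᴳ G H I (sa-gain (⊑-∣ᴳ I E))))
  (∑-expansion E)

-- Signs

-- sgn m = (−1)^⌊m/2⌋

sgn : ℕ → ℤ
sgn 0             = + 1
sgn 1             = + 1
sgn (suc (suc m)) = ℤ.- sgn m

∣sgn∣≡1 : ∀ m → ℤ.∣ sgn m ∣ ≡ 1
∣sgn∣≡1 0             = refl
∣sgn∣≡1 1             = refl
∣sgn∣≡1 (suc (suc m)) = trans (ℤ.∣-i∣≡∣i∣ (sgn m)) (∣sgn∣≡1 m)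

sgn-even-+ : ∀ {m} k → 2 ∣ m → sgn (m + k) ≡ sgn m ℤ.* sgn k
sgn-even-+ k (divides q refl) = go q
  where
  go : ∀ q → sgn (q * 2 + k) ≡ sgn (q * 2) ℤ.* sgn k
  go zero    = sym (ℤ.*-identityˡ (sgn k))
  go (suc q) = trans (cong ℤ.-_ (go q)) (ℤ.neg-distribˡ-* (sgn (q * 2)) (sgn k))

sgn-suc-odd : ∀ m → ¬ 2 ∣ m → sgn (suc m) ≡ ℤ.- sgn m
sgn-suc-odd 0             odd = contradiction (2 ∣0) odd
sgn-suc-odd 1             odd = refl
sgn-suc-odd (suc (suc m)) odd = cong ℤ.-_ (sgn-suc-odd m (odd ∘ ∣m∣n⇒∣m+n (divides 1 refl)))

-- For odd m and k, ⌊(m+k)/2⌋ = ⌊m/2⌋ + ⌊k/2⌋ + 1. This minus sign makes up for the one in the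
-- signed identity.
sgn-odd-+-odd : ∀ {m k} → ¬ 2 ∣ m → ¬ 2 ∣ k → sgn (m + k) ≡ ℤ.- (sgn m ℤ.* sgn k)
sgn-odd-+-odd {m} {k} m-odd k-odd = begin
  sgn (m + k)               ≡⟨ ℤ.neg-involutive (sgn (m + k)) ⟨
  ℤ.- sgn (2 + (m + k))     ≡⟨ cong (λ t → ℤ.- sgn (suc t)) (ℕ.+-suc m k) ⟨
  ℤ.- sgn (suc m + suc k)   ≡⟨ cong ℤ.-_ (sgn-even-+ (suc k) (odd⇒even-suc m m-odd)) ⟩
  ℤ.- (sgn (suc m) ℤ.* sgn (suc k))
    ≡⟨ cong ℤ.-_ (cong₂ ℤ._*_ (sgn-suc-odd m m-odd) (sgn-suc-odd k k-odd)) ⟩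
  ℤ.- (ℤ.- sgn m ℤ.* ℤ.- sgn k) ≡⟨ cong ℤ.-_ (neg*neg (sgn m) (sgn k)) ⟩
  ℤ.- (sgn m ℤ.* sgn k)     ∎
  where
  open ≡-Reasoning
  neg*neg : ∀ i j → ℤ.- i ℤ.* ℤ.- j ≡ i ℤ.* j
  neg*neg i j = trans (sym (ℤ.neg-distribˡ-* i (ℤ.- j))) (trans (cong ℤ.-_ (sym (ℤ.neg-distribʳ-* i j))) (ℤ.neg-involutive (i ℤ.* j)))

*-nonneg : ∀ {i j} → + 0 ℤ.≤ i → + 0 ℤ.≤ j → + 0 ℤ.≤ i ℤ.* j
*-nonneg {+ i} {+ j} _ _ = subst (+ 0 ℤ.≤_) (ℤ.pos-* i j) (ℤ.+≤+ z≤n)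

+∑ : {P : Pred (Subset n) 0ℓ} (P? : Decidable P) (f : Subset n → ℕ) → + ∑ P? f ≡ ∑ℤ P? (λ I → + f I)
+∑ {n} P? f = go (filter P? (subsets n))
  where
  go : ∀ Is → + sum (map f Is) ≡ foldr ℤ._+_ (+ 0) (map (λ I → + f I) Is)
  go []       = refl
  go (I ∷ Is) = trans (ℤ.pos-+ (f I) (sum (map f Is))) (cong (ℤ._+_ (+ f I)) (go Is))

∑ℤ-nonneg : {P : Pred (Subset n) 0ℓ} (P? : Decidable P) (f : Subset n → ℤ) →
  (∀ I → P I → + 0 ℤ.≤ f I) → + 0 ℤ.≤ ∑ℤ P? f
∑ℤ-nonneg P? f f≥0 = subst (+ 0 ℤ.≤_)
  (trans (+∑ P? (λ I → ℤ.∣ f I ∣)) (Sum.Σ-congʳ P? {λ I → + ℤ.∣ f I ∣} {f} (λ I p → ℤ.0≤i⇒+∣i∣≡i (f≥0 I p))))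
  (ℤ.+≤+ z≤n)

*-distribˡ-minus-∑ℤ : {P : Pred (Subset n) 0ℓ} (P? : Decidable P) (c i : ℤ) (f : Subset n → ℤ) →
  c ℤ.* (i ℤ.- ∑ℤ P? f) ≡ c ℤ.* i ℤ.+ ∑ℤ P? (λ I → ℤ.- (c ℤ.* f I))
*-distribˡ-minus-∑ℤ P? c i f = trans (ℤ.*-distribˡ-+ c i (ℤ.- ∑ℤ P? f)) (cong (ℤ._+_ (c ℤ.* i)) (sym (trans
  (∑ℤ-neg P? (λ I → c ℤ.* f I)) (trans (cong ℤ.-_ (∑ℤ-*ˡ P? c f)) (ℤ.neg-distribʳ-* c (∑ℤ P? f))))))

-- Induction on the edges of a graph

-- The list holds every pair that may still carry an edge, so recursion on it replaces counting
-- edges; each step deletes the edge at the head pair, if there is one.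
edge-induction : ∀ {ℓ} (P : Graph n → Set ℓ) →
  (∀ H → (∀ {x y} → ¬ Adj H x y) → P H) →
  (∀ {G H u v} → G ⊑[ u , v ] H → u ∈ V G → v ∈ V G → P G → P H) → ∀ H → P H
edge-induction {n} P edgeless add H = go (cartesianProduct (allFin n) (allFin n)) H
  λ r → Any.map inj₁ (∈-cartesianProduct⁺ (∈-allFin _) (∈-allFin _))
  where
  Joins : Fin n → Fin n → Fin n × Fin n → Set
  Joins x y p = (x , y) ≡ p ⊎ (y , x) ≡ p
  go : ∀ ps H → (∀ {x y} → Adj H x y → Any (Joins x y) ps) → P H
  go []             H covered = edgeless H λ r → case covered r of λ ()
  go ((u , v) ∷ ps) H covered with Graph._~?_ H u v
  ... | no ¬uv = go ps H λ r → skip r (covered r)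
    where
    skip : ∀ {x y} → Adj H x y → Any (Joins x y) ((u , v) ∷ ps) → Any (Joins x y) ps
    skip r (here (inj₁ refl)) = contradiction r ¬uv
    skip r (here (inj₂ refl)) = contradiction (Graph.~-sym H r) ¬uv
    skip r (there i)          = i
  ... | yes uv = add deleted (Graph.~⇒∈ H uv) (Graph.~⇒∈ H (Graph.~-sym H uv))
      (go ps H∖uv λ (r , ¬J) → case covered r of λ { (here j) → contradiction j ¬J ; (there i) → i })
    where
    joins? : ∀ x y → Dec (Joins x y (u , v))
    joins? x y = ×-≡-dec Fin._≟_ Fin._≟_ (x , y) (u , v) ⊎-dec ×-≡-dec Fin._≟_ Fin._≟_ (y , x) (u , v)
    H∖uv : Graph n
    H∖uv = record
      { V        = V H
      ; _~_      = λ x y → Adj H x y × ¬ Joins x y (u , v)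
      ; _~?_     = λ x y → Graph._~?_ H x y ×-dec ¬? (joins? x y)
      ; ~-sym    = λ (r , ¬J) → Graph.~-sym H r , ¬J ∘ ⊎.swap
      ; ~-irrefl = λ eq (r , _) → Graph.~-irrefl H eq r
      ; ~⇒∈      = λ (r , _) → Graph.~⇒∈ H r
      }
    restore : ∀ {x y} → Adj H x y → Dec (Joins x y (u , v)) → Adj H∖uv x y ⊎ (x ≡ u × y ≡ v) ⊎ (x ≡ v × y ≡ u)
    restore r (no ¬J)            = inj₁ (r , ¬J)
    restore r (yes (inj₁ refl)) = inj₂ (inj₁ (refl , refl))
    restore r (yes (inj₂ refl)) = inj₂ (inj₂ (refl , refl))
    deleted : H∖uv ⊑[ u , v ] H
    deleted = record { same-V = refl ; keep = proj₁ ; new = λ {x} {y} r → restore r (joins? x y) }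

sa-edgeless : (G : Graph n) → (∀ {x y} → ¬ Adj G x y) → x ∈ V G → sa G ≡ + 0
sa-edgeless {x = x} G no-edge x∈ = sa-odd-part {A = ⁅ x ⁆} G (λ r → contradiction r no-edge) connected
  (x , x∈p∩q⁺ (x∈ , x∈⁅x⁆ x)) (subst (λ S → ¬ 2 ∣ ∣ S ∣) (sym V∩x) (subst (λ m → ¬ 2 ∣ m) (sym (∣⁅x⁆∣≡1 x)) λ { (divides (suc _) ()) }))
  where
  connected : Connected (G ∣ᴳ ⁅ x ⁆)
  connected y z y∈ z∈ with x∈⁅y⁆⇒x≡y x (p∩q⊆q (V G) ⁅ x ⁆ y∈) | x∈⁅y⁆⇒x≡y x (p∩q⊆q (V G) ⁅ x ⁆ z∈)
  ... | refl | refl = ε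
  V∩x : V G ∩ ⁅ x ⁆ ≡ ⁅ x ⁆
  V∩x = ⊆-antisym (p∩q⊆q (V G) ⁅ x ⁆) λ y∈ →
    x∈p∩q⁺ (subst (_∈ V G) (sym (x∈⁅y⁆⇒x≡y x y∈)) x∈ , y∈)

-- A nonempty induced subgraph has an isolated vertex, an odd component; only the null subgraph
-- contributes.
b-edgeless : (G : Graph n) → (∀ {x y} → ¬ Adj G x y) → b G ≡ + 1
b-edgeless G no-edge = trans
  (Sum.Σ-restrict (_⊆? V G) (_≟ˢ ⊥) {λ I → sa (G ∣ᴳ I)} λ I I⊆V I≢⊥ → nonempty I I⊆V (nonempty? I) I≢⊥)
  (trans (Sum.Σ-≡ (λ I → I ⊆? V G ×-dec I ≟ˢ ⊥) (λ I → sa (G ∣ᴳ I)) ⊥ (λ I → mk⇔ proj₂ (λ { refl → ⊥⊆ , refl })))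
         (sa-null (G ∣ᴳ ⊥) λ (x , x∈) → ∉⊥ (p∩q⊆q (V G) ⊥ x∈)))
  where
  nonempty : ∀ I → I ⊆ V G → Dec (Nonempty I) → I ≢ ⊥ → sa (G ∣ᴳ I) ≡ + 0
  nonempty I I⊆V (no e)         I≢⊥ = contradiction (Empty-unique e) I≢⊥
  nonempty I I⊆V (yes (x , x∈)) _   = sa-edgeless (G ∣ᴳ I) (λ (r , _) → no-edge r) (x∈p∩q⁺ (I⊆V x∈ , x∈))

-- The case that recurs: both sides of an odd bisection are of this kind, and so is `rc H J` when
-- `H` is and `J` is even.
BSign : Graph n → Set
BSign G = Connected G → ¬ 2 ∣ ∣ V G ∣ → + 0 ℤ.≤ sgn ∣ V G ∣ ℤ.* b G

edgeless-connected⇒singleton : (G : Graph n) → (∀ {x y} → ¬ Adj G x y) → Connected G → x ∈ V G → ∣ V G ∣ ≡ 1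
edgeless-connected⇒singleton {x = x} G no-edge conn x∈ = trans (cong ∣_∣ V≡x) (∣⁅x⁆∣≡1 x)
  where
  trivial : ∀ {y z} → Path G y z → z ≡ y
  trivial ε       = refl
  trivial (r ◅ _) = contradiction r no-edge
  V≡x : V G ≡ ⁅ x ⁆
  V≡x = subset-ext λ y → mk⇔ (λ y∈ → from x∈⁅y⁆⇔x≡y (trivial (conn x y x∈ y∈)))
                               (λ y∈ → subst (_∈ V G) (sym (x∈⁅y⁆⇒x≡y x y∈)) x∈)

b-sign-edgeless : (G : Graph n) → (∀ {x y} → ¬ Adj G x y) → BSign G
b-sign-edgeless G no-edge conn odd = subst (+ 0 ℤ.≤_)
  (sym (cong₂ (λ m i → sgn m ℤ.* i) (edgeless-connected⇒singleton G no-edge conn (proj₂ (odd⇒nonempty odd))) (b-edgeless G no-edge)))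
  (ℤ.+≤+ z≤n)

-- `b` is the product over the two sides, while the sign of the total order is minus the product of
-- their signs by `sgn-odd-+-odd`.
bisection-sign : (G : Graph n) (B : Bisection G) → ¬ 2 ∣ ∣ V G ∩ part B ∣ → ¬ 2 ∣ ∣ V G ∩ ∁ (part B) ∣ →
  BSign (G ∣ᴳ part B) → BSign (G ∣ᴳ ∁ (part B)) → + 0 ℤ.≤ ℤ.- (sgn ∣ V G ∣ ℤ.* b G)
bisection-sign G B oddˡ oddʳ signˡ signʳ = subst (+ 0 ℤ.≤_)
  (sym (rearrange (sgn ∣ V G ∣) (b G) (sgn ∣ V G ∩ part B ∣) (sgn ∣ V G ∩ ∁ (part B) ∣) (b (G ∣ᴳ part B)) (b (G ∣ᴳ ∁ (part B)))
    (trans (cong sgn (sym (∣p∩q∣+∣p∩∁q∣≡∣p∣ (V G) (part B)))) (sgn-odd-+-odd oddˡ oddʳ))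
    (b-split G (part-closed B))))
  (*-nonneg (signˡ (connectedˡ B) oddˡ) (signʳ (connectedʳ B) oddʳ))
  where
  rearrange : ∀ s β s₁ s₂ β₁ β₂ → s ≡ ℤ.- (s₁ ℤ.* s₂) → β ≡ β₁ ℤ.* β₂ → ℤ.- (s ℤ.* β) ≡ (s₁ ℤ.* β₁) ℤ.* (s₂ ℤ.* β₂)
  rearrange _ _ s₁ s₂ β₁ β₂ refl refl = solve 4
    (λ s₁ s₂ β₁ β₂ → :- (:- (s₁ :* s₂) :* (β₁ :* β₂)) := (s₁ :* β₁) :* (s₂ :* β₂)) refl s₁ s₂ β₁ β₂

-- Shared by `b-sign` and `sa-sign`, with `t` the value of `b` or `sa` at `rc H J`. The sign
-- hypotheses are asked for only under an odd bisection, where `J` is known to be even; otherwise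
-- the term is zero.
gain-term-sign : G ⊑[ u , v ] H → Gain G H J → (OddBisection (G ∣ᴳ J) → ∀ A → BSign (G ∣ᴳ J ∣ᴳ A)) →
  (t : ℤ) → (OddBisection (G ∣ᴳ J) → + 0 ℤ.≤ sgn ∣ V H ─ J ∣ ℤ.* t) → + 0 ℤ.≤ ℤ.- (sgn ∣ V H ∣ ℤ.* (b (G ∣ᴳ J) ℤ.* t))
gain-term-sign {G = G} {H = H} {J = J} E gain@((J⊆V , _) , _) signs t t-sign with gain-cases E gain
... | inj₁ b≡0 = subst (+ 0 ℤ.≤_) (sym (vanish (sgn ∣ V H ∣) (b (G ∣ᴳ J)) b≡0)) (ℤ.+≤+ z≤n)
  where
  vanish : ∀ s β → β ≡ + 0 → ℤ.- (s ℤ.* (β ℤ.* t)) ≡ + 0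
  vanish s β refl = cong ℤ.-_ (trans (cong (s ℤ.*_) (ℤ.*-zeroˡ t)) (ℤ.*-zeroʳ s))
... | inj₂ bisection@(B , oddˡ , oddʳ) = subst (+ 0 ℤ.≤_)
  (sym (rearrange (sgn ∣ V H ∣) (sgn ∣ V G ∩ J ∣) (sgn ∣ V H ─ J ∣) (b (G ∣ᴳ J)) sgn-V))
  (*-nonneg (bisection-sign (G ∣ᴳ J) B oddˡ oddʳ (signs bisection (part B))
    (signs bisection (∁ (part B)))) (t-sign bisection))
  where
  sgn-V : sgn ∣ V H ∣ ≡ sgn ∣ V G ∩ J ∣ ℤ.* sgn ∣ V H ─ J ∣
  sgn-V = trans (cong sgn (trans (sym (∣q∣+∣p─q∣≡∣p∣ J⊆V)) (cong (λ S → ∣ S ∣ + ∣ V H ─ J ∣) (sym (gain⇒V∩ E gain)))))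
    (sgn-even-+ ∣ V H ─ J ∣ (oddBisection⇒even (G ∣ᴳ J) bisection))
  rearrange : ∀ s s₁ s₂ β → s ≡ s₁ ℤ.* s₂ → ℤ.- (s ℤ.* (β ℤ.* t)) ≡ ℤ.- (s₁ ℤ.* β) ℤ.* (s₂ ℤ.* t)
  rearrange _ s₁ s₂ β refl = solve 4
    (λ s₁ s₂ β t → :- ((s₁ :* s₂) :* (β :* t)) := :- (s₁ :* β) :* (s₂ :* t)) refl s₁ s₂ β t

rc-smaller : (H : Graph n) → u ∈ J → J ⊆ V H → ∣ V (rc H J) ∣ < ∣ V H ∣
rc-smaller {J = J} H u∈J J⊆V = p∩q≢∅⇒∣p─q∣<∣p∣ (V H) J (_ , x∈p∩q⁺ (J⊆V u∈J , u∈J))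

-- The hypothesis on smaller vertex sets is a premise of the edge-induction motive: deleting an edge
-- keeps the vertices, so it carries over to `G`, and it serves the terms with `rc H J` and the
-- sides of `G ∣ᴳ J`.
b-sign : (G : Graph n) → BSign G
b-sign = graph-induction BSign λ H → edge-induction (λ H → (∀ K → ∣ V K ∣ < ∣ V H ∣ → BSign K) → BSign H)
  (λ H no-edge _ → b-sign-edgeless H no-edge) add-edge H
  where
  add-edge : {G H : Graph n} {u v : Fin n} → G ⊑[ u , v ] H → u ∈ V G → v ∈ V G →
    ((∀ K → ∣ V K ∣ < ∣ V G ∣ → BSign K) → BSign G) → (∀ K → ∣ V K ∣ < ∣ V H ∣ → BSign K) → BSign H
  add-edge {n} {G} {H} {u} {v} E u∈ v∈ signG IH conn odd = subst (+ 0 ℤ.≤_) (sym expand)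
    (ℤ.+-mono-≤ (old (connected-or-bisected E conn u∈)) (∑ℤ-nonneg (gain? G H) _ term))
    where
    expand : sgn ∣ V H ∣ ℤ.* b H ≡ sgn ∣ V H ∣ ℤ.* b G ℤ.+ ∑ℤ (gain? G H) (λ J → ℤ.- (sgn ∣ V H ∣ ℤ.* (b (G ∣ᴳ J) ℤ.* b (rc H J))))
    expand = trans (cong (sgn ∣ V H ∣ ℤ.*_) (b-gain E))
      (*-distribˡ-minus-∑ℤ (gain? G H) (sgn ∣ V H ∣) (b G) (λ J → b (G ∣ᴳ J) ℤ.* b (rc H J)))
    oddG : ¬ 2 ∣ ∣ V G ∣
    oddG = subst (λ S → ¬ 2 ∣ ∣ S ∣) (sym (same-V E)) odd
    vanish : b G ≡ + 0 → + 0 ℤ.≤ sgn ∣ V H ∣ ℤ.* b G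
    vanish b≡0 = ℤ.≤-reflexive (sym (trans (cong (sgn ∣ V H ∣ ℤ.*_) b≡0) (ℤ.*-zeroʳ (sgn ∣ V H ∣))))
    old : Connected G ⊎ (∃ λ (B : Bisection G) → u ∈ part B × v ∉ part B) → + 0 ℤ.≤ sgn ∣ V H ∣ ℤ.* b G
    old (inj₁ connG) = subst (λ S → + 0 ℤ.≤ sgn ∣ S ∣ ℤ.* b G) (same-V E)
      (signG (λ K K<G → IH K (subst (λ S → ∣ V K ∣ < ∣ S ∣) (same-V E) K<G)) connG oddG)
    old (inj₂ (B , u∈B , v∉B)) with 2 ∣? ∣ V G ∩ part B ∣ | 2 ∣? ∣ V G ∩ ∁ (part B) ∣
    ... | yes evenˡ | _ = vanish (b-even-part G (part-closed B) (connectedˡ B) (u , x∈p∩q⁺ (u∈ , u∈B)) evenˡ)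
    ... | _ | yes evenʳ = vanish (b-even-part G (closed-∁ G (part-closed B)) (connectedʳ B) (v , x∈p∩q⁺ (v∈ , x∉p⇒x∈∁p v∉B)) evenʳ)
    -- Two odd sides would make the order even.
    ... | no oddˡ | no oddʳ = contradiction (oddBisection⇒even G (B , oddˡ , oddʳ)) oddG
    term : ∀ J → Gain G H J → + 0 ℤ.≤ ℤ.- (sgn ∣ V H ∣ ℤ.* (b (G ∣ᴳ J) ℤ.* b (rc H J)))
    term J gain@((J⊆V , _) , _) = gain-term-sign E gain
      (λ bisection A → IH (G ∣ᴳ J ∣ᴳ A) (smaller bisection A)) (b (rc H J))
      (λ bisection → IH (rc H J) (rc-smaller H (gain⇒∋u E gain) J⊆V) (rc-connected H J conn)
        λ even → odd (subst (2 ∣_) (∣q∣+∣p─q∣≡∣p∣ J⊆V) (∣m∣n⇒∣m+n (gain-odd-bisection⇒even E gain bisection) even)))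
      where
      -- `J` is even and `V H` odd, so `J` is a proper subset.
      smaller : OddBisection (G ∣ᴳ J) → ∀ A → ∣ (V G ∩ J) ∩ A ∣ < ∣ V H ∣
      smaller bisection A = ℕ.≤-<-trans (ℕ.≤-trans (∣p∩q∣≤∣p∣ (V G ∩ J) A) (∣p∩q∣≤∣q∣ (V G) J))
        (ℕ.≤∧≢⇒< (p⊆q⇒∣p∣≤∣q∣ J⊆V) λ ∣J∣≡∣V∣ → odd (subst (2 ∣_) ∣J∣≡∣V∣ (gain-odd-bisection⇒even E gain bisection)))

-- Here `J` may be all of `V H`, so the sides of `G ∣ᴳ J` take their sign from `b-sign`; only
-- `rc H J` uses the induction on vertices.
sa-sign : (G : Graph n) → + 0 ℤ.≤ sgn ∣ V G ∣ ℤ.* sa G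
sa-sign = graph-induction SaSign λ H → edge-induction (λ H → (∀ K → ∣ V K ∣ < ∣ V H ∣ → SaSign K) → SaSign H)
  (λ H no-edge _ → edgeless H no-edge (nonempty? (V H))) add-edge H
  where
  SaSign : Graph n → Set
  SaSign G = + 0 ℤ.≤ sgn ∣ V G ∣ ℤ.* sa G
  edgeless : (H : Graph n) → (∀ {x y} → ¬ Adj H x y) → Dec (Nonempty (V H)) → SaSign H
  edgeless H no-edge (yes (x , x∈)) = ℤ.≤-reflexive (sym (trans
    (cong (sgn ∣ V H ∣ ℤ.*_) (sa-edgeless H no-edge x∈)) (ℤ.*-zeroʳ (sgn ∣ V H ∣))))
  edgeless H no-edge (no e) = subst (+ 0 ℤ.≤_)
    (sym (cong₂ (λ m i → sgn m ℤ.* i) (Empty⇒∣p∣≡0 (V H) e) (sa-null H e))) (ℤ.+≤+ z≤n)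
  add-edge : {G H : Graph n} {u v : Fin n} → G ⊑[ u , v ] H → u ∈ V G → v ∈ V G →
    ((∀ K → ∣ V K ∣ < ∣ V G ∣ → SaSign K) → SaSign G) → (∀ K → ∣ V K ∣ < ∣ V H ∣ → SaSign K) → SaSign H
  add-edge {n} {G} {H} {u} {v} E _ _ signG IH = subst (+ 0 ℤ.≤_) (sym expand)
    (ℤ.+-mono-≤ old (∑ℤ-nonneg (gain? G H) _ term))
    where
    expand : sgn ∣ V H ∣ ℤ.* sa H ≡ sgn ∣ V H ∣ ℤ.* sa G ℤ.+ ∑ℤ (gain? G H) (λ J → ℤ.- (sgn ∣ V H ∣ ℤ.* (b (G ∣ᴳ J) ℤ.* sa (rc H J))))
    expand = trans (cong (sgn ∣ V H ∣ ℤ.*_) (sa-gain E))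
      (*-distribˡ-minus-∑ℤ (gain? G H) (sgn ∣ V H ∣) (sa G) (λ J → b (G ∣ᴳ J) ℤ.* sa (rc H J)))
    old : + 0 ℤ.≤ sgn ∣ V H ∣ ℤ.* sa G
    old = subst (λ S → + 0 ℤ.≤ sgn ∣ S ∣ ℤ.* sa G) (same-V E)
      (signG (λ K K<G → IH K (subst (λ S → ∣ V K ∣ < ∣ S ∣) (same-V E) K<G)))
    term : ∀ J → Gain G H J → + 0 ℤ.≤ ℤ.- (sgn ∣ V H ∣ ℤ.* (b (G ∣ᴳ J) ℤ.* sa (rc H J)))
    term J gain@((J⊆V , _) , _) = gain-term-sign E gain (λ _ A → b-sign (G ∣ᴳ J ∣ᴳ A)) (sa (rc H J))
      (λ _ → IH (rc H J) (rc-smaller H (gain⇒∋u E gain) J⊆V))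

-- Unsigned recursion

+a : (G : Graph n) → + a G ≡ sgn ∣ V G ∣ ℤ.* sa G
+a G = trans (cong +_ (sym ∣sgn*sa∣)) (ℤ.0≤i⇒+∣i∣≡i (sa-sign G))
  where
  ∣sgn*sa∣ : ℤ.∣ sgn ∣ V G ∣ ℤ.* sa G ∣ ≡ a G
  ∣sgn*sa∣ = trans (ℤ.abs-* (sgn ∣ V G ∣) (sa G)) (trans (cong (_* a G) (∣sgn∣≡1 ∣ V G ∣)) (ℕ.*-identityˡ (a G)))

-- Multiplied by `sgn ∣ V H ∣`, the signed identity has only nonnegative terms, each equal to its
-- absolute value.
a-gain : G ⊑[ u , v ] H → a H ≡ a G + ∑ (gain? G H) (λ J → ℤ.∣ b (G ∣ᴳ J) ∣ * a (rc H J))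
a-gain {G = G} {H = H} E = ℤ.+-injective (begin
  + a H
    ≡⟨ +a H ⟩
  sgn ∣ V H ∣ ℤ.* sa H
    ≡⟨ cong (sgn ∣ V H ∣ ℤ.*_) (sa-gain E) ⟩
  sgn ∣ V H ∣ ℤ.* (sa G ℤ.- ∑ℤ (gain? G H) (λ J → b (G ∣ᴳ J) ℤ.* sa (rc H J)))
    ≡⟨ *-distribˡ-minus-∑ℤ (gain? G H) (sgn ∣ V H ∣) (sa G) (λ J → b (G ∣ᴳ J) ℤ.* sa (rc H J)) ⟩
  sgn ∣ V H ∣ ℤ.* sa G ℤ.+ ∑ℤ (gain? G H) (λ J → ℤ.- (sgn ∣ V H ∣ ℤ.* (b (G ∣ᴳ J) ℤ.* sa (rc H J))))
    ≡⟨ cong₂ ℤ._+_ (sym old) (trans (Sum.Σ-congʳ (gain? G H) term) (sym (+∑ (gain? G H) (λ J → ℤ.∣ b (G ∣ᴳ J) ∣ * a (rc H J))))) ⟩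
  + a G ℤ.+ + ∑ (gain? G H) (λ J → ℤ.∣ b (G ∣ᴳ J) ∣ * a (rc H J))
    ≡⟨ ℤ.pos-+ (a G) _ ⟨
  + (a G + ∑ (gain? G H) (λ J → ℤ.∣ b (G ∣ᴳ J) ∣ * a (rc H J)))
    ∎)
  where
  open ≡-Reasoning
  old : + a G ≡ sgn ∣ V H ∣ ℤ.* sa G
  old = trans (+a G) (cong (λ S → sgn ∣ S ∣ ℤ.* sa G) (same-V E))
  ∣-s[βt]∣ : ∀ m β t → ℤ.∣ ℤ.- (sgn m ℤ.* (β ℤ.* t)) ∣ ≡ ℤ.∣ β ∣ * ℤ.∣ t ∣
  ∣-s[βt]∣ m β t = trans (ℤ.∣-i∣≡∣i∣ (sgn m ℤ.* (β ℤ.* t))) (trans (ℤ.abs-* (sgn m) (β ℤ.* t))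
    (trans (cong₂ _*_ (∣sgn∣≡1 m) (ℤ.abs-* β t)) (ℕ.*-identityˡ _)))
  term : ∀ J → Gain G H J → ℤ.- (sgn ∣ V H ∣ ℤ.* (b (G ∣ᴳ J) ℤ.* sa (rc H J))) ≡ + (ℤ.∣ b (G ∣ᴳ J) ∣ * a (rc H J))
  term J gain = trans (sym (ℤ.0≤i⇒+∣i∣≡i (gain-term-sign E gain (λ _ A → b-sign (G ∣ᴳ J ∣ᴳ A)) (sa (rc H J)) (λ _ → sa-sign (rc H J)))))
    (cong +_ (∣-s[βt]∣ ∣ V H ∣ (b (G ∣ᴳ J)) (sa (rc H J))))

-- Sums over induced subgraphs of fixed order

module NatSum = SubsetSum ℕ.+-0-isCommutativeMonoid

∑-*ˡ : {P : Pred (Subset n) 0ℓ} (P? : Decidable P) (c : ℕ) (f : Subset n → ℕ) → ∑ P? (λ I → c * f I) ≡ c * ∑ P? f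
∑-*ˡ P? c f = NatSum.Σ-hom P? f (c *_) (ℕ.*-zeroʳ c) (ℕ.*-distribˡ-+ c)

gained : Graph n → Graph n → Subset n → ℕ
gained G H I = ∑ (λ J → gain? G H J ×-dec J ⊆? I) (λ J → ℤ.∣ b (G ∣ᴳ J) ∣ * a (rc H J ∣ᴳ I))

a-gain-∣ᴳ : {G H : Graph n} (I : Subset n) → G ⊑[ u , v ] H → a (H ∣ᴳ I) ≡ a (G ∣ᴳ I) + gained G H I
a-gain-∣ᴳ {G = G} {H = H} I E = trans (a-gain {G = G ∣ᴳ I} {H = H ∣ᴳ I} (⊑-∣ᴳ I E)) (cong (_+_ (a (G ∣ᴳ I))) sums)
  where
  sums : ∑ (gain? (G ∣ᴳ I) (H ∣ᴳ I)) (λ J → ℤ.∣ b (G ∣ᴳ I ∣ᴳ J) ∣ * a (rc (H ∣ᴳ I) J)) ≡ gained G H I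
  inner : ∀ J → Gain (G ∣ᴳ I) (H ∣ᴳ I) J →
    ℤ.∣ b (G ∣ᴳ I ∣ᴳ J) ∣ * a (rc (H ∣ᴳ I) J) ≡ ℤ.∣ b (G ∣ᴳ J) ∣ * a (rc H J ∣ᴳ I)
  inner J gain = cong₂ (λ β s → ℤ.∣ β ∣ * ℤ.∣ s ∣) (b-≃ (∣ᴳ-∣ᴳ-⊆ G J⊆I)) (sa-≃ (rc-∣ᴳ H J⊆I))
    where
    J⊆I : J ⊆ I
    J⊆I = proj₂ (to (gain-∣ᴳ G H I J) gain)
  sums = NatSum.Σ-cong (gain? (G ∣ᴳ I) (H ∣ᴳ I)) (λ J → gain? G H J ×-dec J ⊆? I) (gain-∣ᴳ G H I) inner

-- Evenness makes the division exact. The index is an integer, so for `j` above `2i` both equations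
-- are unsolvable rather than truncated.
half-shift : ∀ {j k m} i → 2 ∣ j → j + k ≡ m → (+ m ≡ + 2 ℤ.* i) ⇔ (+ k ≡ + 2 ℤ.* (i - + (j / 2)))
half-shift {k = k} i (divides q refl) refl rewrite m*n/n≡m q 2 {{_}} = mk⇔
  (λ eq → begin
    + k                                   ≡⟨ solve 2 (λ q k → k := (q :* con (+ 2) :+ k) :- con (+ 2) :* q) refl (+ q) (+ k) ⟩
    (+ q ℤ.* + 2 ℤ.+ + k) - + 2 ℤ.* + q   ≡⟨ cong (_- + 2 ℤ.* + q) (trans (sym +-shift) eq) ⟩
    + 2 ℤ.* i - + 2 ℤ.* + q               ≡⟨ solve 2 (λ i q → con (+ 2) :* i :- con (+ 2) :* q := con (+ 2) :* (i :- q)) refl i (+ q) ⟩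
    + 2 ℤ.* (i - + q)                     ∎)
  (λ eq → begin
    + (q * 2 + k)                         ≡⟨ +-shift ⟩
    + q ℤ.* + 2 ℤ.+ + k                   ≡⟨ cong (ℤ._+_ (+ q ℤ.* + 2)) eq ⟩
    + q ℤ.* + 2 ℤ.+ + 2 ℤ.* (i - + q)     ≡⟨ solve 2 (λ i q → q :* con (+ 2) :+ con (+ 2) :* (i :- q) := con (+ 2) :* i) refl i (+ q) ⟩
    + 2 ℤ.* i                             ∎)
  where
  open ≡-Reasoning
  +-shift : + (q * 2 + k) ≡ + q ℤ.* + 2 ℤ.+ + k
  +-shift = trans (ℤ.pos-+ (q * 2) k) (cong (ℤ._+ + k) (ℤ.pos-* q 2))

Graded : ℤ → Graph n → Pred (Subset n) 0ℓ
Graded i G I = I ⊆ V G × + ∣ I ∣ ≡ + 2 ℤ.* i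

graded? : (i : ℤ) (G : Graph n) → Decidable (Graded i G)
graded? i G I = (I ⊆? V G) ×-dec (+ ∣ I ∣ ℤ.≟ + 2 ℤ.* i)

graded-interval⇔ : (i : ℤ) (H : Graph n) → J ⊆ V H → 2 ∣ ∣ J ∣ → ∀ I K →
  ((J ⊆ I × Graded i H I) × K ≡ I ─ J) ⇔ (Graded (i - + (∣ J ∣ / 2)) (rc H J) K × I ≡ J ∪ K)
graded-interval⇔ {J = J} i H J⊆V even I K = mk⇔ forth back
  where
  shift : J ⊆ I → K ≡ I ─ J → (+ ∣ I ∣ ≡ + 2 ℤ.* i) ⇔ (+ ∣ K ∣ ≡ + 2 ℤ.* (i - + (∣ J ∣ / 2)))
  shift J⊆I refl = half-shift i even (∣q∣+∣p─q∣≡∣p∣ J⊆I)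
  forth : (J ⊆ I × Graded i H I) × K ≡ I ─ J → Graded (i - + (∣ J ∣ / 2)) (rc H J) K × I ≡ J ∪ K
  forth ((J⊆I , I⊆V , size) , K≡) = (proj₁ interval , to (shift J⊆I K≡) size) , proj₂ interval
    where
    interval : K ⊆ V H ─ J × I ≡ J ∪ K
    interval = to (interval⇔ J⊆V I K) ((J⊆I , I⊆V) , K≡)
  back : Graded (i - + (∣ J ∣ / 2)) (rc H J) K × I ≡ J ∪ K → (J ⊆ I × Graded i H I) × K ≡ I ─ J
  back ((K⊆ , size) , I≡) =
    (proj₁ (proj₁ interval) , proj₂ (proj₁ interval) , from (shift (proj₁ (proj₁ interval)) (proj₂ interval)) size) , proj₂ interval
    where
    interval : (J ⊆ I × I ⊆ V H) × K ≡ I ─ J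
    interval = from (interval⇔ J⊆V I K) (K⊆ , I≡)

aᵢ-gain : {G H : Graph n} (i : ℤ) → G ⊑[ u , v ] H →
  aᵢ i H ≡ aᵢ i G + ∑ (gain? G H) (λ J → ℤ.∣ b (G ∣ᴳ J) ∣ * aᵢ (i - + (∣ J ∣ / 2)) (rc H J))
aᵢ-gain {n} {G = G} {H = H} i E = trans ∑-step (trans ∑-split (cong₂ _+_ ∑-old ∑-gained))
  where
  open ≡-Reasoning
  term : Subset n → Subset n → ℕ
  term I J = ℤ.∣ b (G ∣ᴳ J) ∣ * a (rc H J ∣ᴳ I)
  graded-≡ : ∀ I → Graded i H I ⇔ Graded i G I
  graded-≡ I = mk⇔
    (λ (I⊆ , size) → (λ {x} x∈ → subst (x ∈_) (sym (same-V E)) (I⊆ x∈)) , size)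
    (λ (I⊆ , size) → (λ {x} x∈ → subst (x ∈_) (same-V E) (I⊆ x∈)) , size)
  rearrange : ∀ I J → (Graded i H I × Gain G H J × J ⊆ I) ⇔ (Gain G H J × J ⊆ I × Graded i H I)
  rearrange I J = mk⇔ forth back
    where
    forth : Graded i H I × Gain G H J × J ⊆ I → Gain G H J × J ⊆ I × Graded i H I
    forth (p , q , r) = q , r , p
    back : Gain G H J × J ⊆ I × Graded i H I → Graded i H I × Gain G H J × J ⊆ I
    back (q , r , p) = p , q , r
  inner : ∀ J → Gain G H J → b (G ∣ᴳ J) ≡ + 0 ⊎ OddBisection (G ∣ᴳ J) →
    ∑ (λ I → J ⊆? I ×-dec graded? i H I) (λ I → term I J) ≡ ℤ.∣ b (G ∣ᴳ J) ∣ * aᵢ (i - + (∣ J ∣ / 2)) (rc H J)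
  inner J gain (inj₁ b≡0) = trans
    (NatSum.Σ-ε (λ I → J ⊆? I ×-dec graded? i H I) (λ I _ → cong (λ β → ℤ.∣ β ∣ * a (rc H J ∣ᴳ I)) b≡0))
    (sym (cong (λ β → ℤ.∣ β ∣ * aᵢ (i - + (∣ J ∣ / 2)) (rc H J)) b≡0))
  -- The evenness of `J` that the index shift requires is read off from the bisection.
  inner J gain@((J⊆V , _) , _) (inj₂ bisection) = begin
    ∑ (λ I → J ⊆? I ×-dec graded? i H I) (λ I → ℤ.∣ b (G ∣ᴳ J) ∣ * a (rc H J ∣ᴳ I))
      ≡⟨ ∑-*ˡ (λ I → J ⊆? I ×-dec graded? i H I) ℤ.∣ b (G ∣ᴳ J) ∣ (λ I → a (rc H J ∣ᴳ I)) ⟩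
    ℤ.∣ b (G ∣ᴳ J) ∣ * ∑ (λ I → J ⊆? I ×-dec graded? i H I) (λ I → a (rc H J ∣ᴳ I))
      ≡⟨ cong (ℤ.∣ b (G ∣ᴳ J) ∣ *_) (NatSum.Σ-reindex (λ I → J ⊆? I ×-dec graded? i H I) (graded? (i - + (∣ J ∣ / 2)) (rc H J))
           (λ I → a (rc H J ∣ᴳ I)) (J ∪_) (_─ J)
           (graded-interval⇔ i H J⊆V (gain-odd-bisection⇒even E gain bisection))) ⟩
    ℤ.∣ b (G ∣ᴳ J) ∣ * ∑ (graded? (i - + (∣ J ∣ / 2)) (rc H J)) (λ K → a (rc H J ∣ᴳ (J ∪ K)))
      ≡⟨ cong (ℤ.∣ b (G ∣ᴳ J) ∣ *_) (NatSum.Σ-congʳ (graded? (i - + (∣ J ∣ / 2)) (rc H J))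
           (λ K _ → cong ℤ.∣_∣ (sa-≃ (rc-∪ H J K)))) ⟩
    ℤ.∣ b (G ∣ᴳ J) ∣ * aᵢ (i - + (∣ J ∣ / 2)) (rc H J)
      ∎
  ∑-step : ∑ (graded? i H) (λ I → a (H ∣ᴳ I)) ≡ ∑ (graded? i H) (λ I → a (G ∣ᴳ I) + gained G H I)
  ∑-step = NatSum.Σ-congʳ (graded? i H) {λ I → a (H ∣ᴳ I)} {λ I → a (G ∣ᴳ I) + gained G H I} (λ I _ → a-gain-∣ᴳ {G = G} {H = H} I E)
  ∑-split : ∑ (graded? i H) (λ I → a (G ∣ᴳ I) + gained G H I) ≡ ∑ (graded? i H) (λ I → a (G ∣ᴳ I)) + ∑ (graded? i H) (gained G H)
  ∑-split = NatSum.Σ-∙ (graded? i H) (λ I → a (G ∣ᴳ I)) (gained G H)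
  ∑-old : ∑ (graded? i H) (λ I → a (G ∣ᴳ I)) ≡ aᵢ i G
  ∑-old = NatSum.Σ-cong (graded? i H) (graded? i G) graded-≡ (λ _ _ → refl)
  ∑-gained : ∑ (graded? i H) (gained G H) ≡ ∑ (gain? G H) (λ J → ℤ.∣ b (G ∣ᴳ J) ∣ * aᵢ (i - + (∣ J ∣ / 2)) (rc H J))
  ∑-gained = trans
    (NatSum.Σ-swap (graded? i H) (λ I J → gain? G H J ×-dec J ⊆? I) (λ J I → J ⊆? I ×-dec graded? i H I) (gain? G H) term rearrange)
    (NatSum.Σ-congʳ (gain? G H) (λ J gain → inner J gain (gain-cases E gain)))

⊑-+ᴳ : (G : Graph n) (e : VertexPair G) → G ⊑[ VertexPair.u e , VertexPair.v e ] G +ᴳ e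
⊑-+ᴳ G e = record { same-V = refl ; keep = inj₁ ; new = id }

mainTheorem8 : ∀ {n} (G : Graph n) (e : VertexPair G) (i : ℕ) →
    aᵢ (+ i) (G +ᴳ e) ≡
    aᵢ (+ i) G
    + ∑ (λ J → ec? (G +ᴳ e) J ×-dec ¬? (ec? G J))
    (λ J → ℤ.∣ b (G ∣ᴳ J) ∣ * aᵢ (+ i - + (∣ J ∣ / 2)) (reconnectedComplement (G +ᴳ e) J))
mainTheorem8 G e i = aᵢ-gain (+ i) (⊑-+ᴳ G e)
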